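{- Let $G$ be a $2r$-regular graph of order $p$ with $r\ge 1$, $p\ge 3$, $p-2r+2\ge 2$ and $\chi(G)=\chi_{la}(G)$. Let $G_0=G$ and $G_{k+1}=G_k\vee C_{p-2r+2}$ for $k\ge 0$. Then $G_{k+1}$ is a $(2r+(k+1)(p-2r+2))$-regular graph of order $p+(k+1)(p-2r+2)$, and for all $k\ge 0$, $$\chi_{la}(G_k)=\begin{cases}\chi_{la}(G)+2k & \text{if } p \text{ is even},\\ \chi_{la}(G)+3k & \text{otherwise}.\end{cases}$$
   Context: $C_n$ is the cycle on $n$ vertices; each $C_{p-2r+2}$ in the iteration is a fresh vertex-disjoint copy. For vertex-disjoint graphs $G,H$, the join $G\vee H$ has vertex set $V(G)\cup V(H)$ and edge set $E(G)\cup E(H)\cup\{uv: u\in V(G), v\in V(H)\}$. $\chi$ is the chromatic number. For a simple graph with $q$ edges, a bijection $f:E\to\{1,\dots,q\}$ is a local antimagic labeling if $f^+(u)\neq f^+(v)$ for every edge $uv$, where $f^+(u)=\sum_{e\ni u} f(e)$; $\chi_{la}$ is the minimum number of distinct values of $f^+$ over all local antimagic labelings. -}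

module Defs where

open import Data.Nat using (ℕ; zero; suc; _+_; _*_; _∸_; _≡ᵇ_; _%_; _≤_)
open import Data.Nat.Properties using (_≟_)
open import Data.Bool using (Bool; true; false; not; _∧_; _∨_; T; T?; if_then_else_)
open import Data.Bool.Properties using (∨-comm)
open import Data.Fin using (Fin; toℕ; splitAt; _<_)
open import Data.Fin.Properties using () renaming (_≟_ to _≟F_)
open import Data.Sum using (_⊎_; inj₁; inj₂)
open import Data.Product using (Σ; _×_; _,_; ∃)
open import Data.List using (List; length; filter; map; allFin; deduplicate)
open import Data.Nat.ListAction using (sum)
open import Function.Bundles using (_↔_; Inverse)
open import Relation.Nullary using (¬_; does)
open import Relation.Binary.PropositionalEquality using (_≡_; _≢_; refl; cong₂)

record Graph (n : ℕ) : Set where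
  field
    adj   : Fin n → Fin n → Bool
    sym   : ∀ u v → adj u v ≡ adj v u
    irref : ∀ u → adj u u ≡ false
open Graph public

degree : ∀ {n} → Graph n → Fin n → ℕ
degree {n} G u = length (filter (λ v → T? (adj G u v)) (allFin n))

IsRegular : ∀ {n} → Graph n → ℕ → Set
IsRegular {n} G d = ∀ u → degree G u ≡ d

joinAdj : ∀ {a b} → Graph a → Graph b → Fin a ⊎ Fin b → Fin a ⊎ Fin b → Bool
joinAdj G H (inj₁ i) (inj₁ j) = adj G i j
joinAdj G H (inj₂ i) (inj₂ j) = adj H i j
joinAdj G H (inj₁ i) (inj₂ j) = true
joinAdj G H (inj₂ i) (inj₁ j) = true

joinAdj-sym : ∀ {a b} (G : Graph a) (H : Graph b) s t →
              joinAdj G H s t ≡ joinAdj G H t s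
joinAdj-sym G H (inj₁ i) (inj₁ j) = sym G i j
joinAdj-sym G H (inj₂ i) (inj₂ j) = sym H i j
joinAdj-sym G H (inj₁ i) (inj₂ j) = refl
joinAdj-sym G H (inj₂ i) (inj₁ j) = refl

joinAdj-irref : ∀ {a b} (G : Graph a) (H : Graph b) s → joinAdj G H s s ≡ false
joinAdj-irref G H (inj₁ i) = irref G i
joinAdj-irref G H (inj₂ i) = irref H i

_∨G_ : ∀ {a b} → Graph a → Graph b → Graph (a + b)
_∨G_ {a} G H = record
  { adj   = λ x y → joinAdj G H (splitAt a x) (splitAt a y)
  ; sym   = λ x y → joinAdj-sym G H (splitAt a x) (splitAt a y)
  ; irref = λ x → joinAdj-irref G H (splitAt a x)
  }

-- The cycle C_m on vertices 0,…,m-1: i ~ j iff i ≠ j and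
-- j ≡ i+1 (mod m) or i ≡ j+1 (mod m).  (For m ≥ 3 this is the cycle C_m.)

≡ᵇ-refl : ∀ n → (n ≡ᵇ n) ≡ true
≡ᵇ-refl zero = refl
≡ᵇ-refl (suc n) = ≡ᵇ-refl n

≡ᵇ-sym : ∀ m n → (m ≡ᵇ n) ≡ (n ≡ᵇ m)
≡ᵇ-sym zero zero = refl
≡ᵇ-sym zero (suc n) = refl
≡ᵇ-sym (suc m) zero = refl
≡ᵇ-sym (suc m) (suc n) = ≡ᵇ-sym m n

cycle : (m : ℕ) → Graph m
cycle zero = record { adj = λ () ; sym = λ () ; irref = λ () }
cycle (suc m') = record { adj = cadj ; sym = csym ; irref = cirr }
  where
  nxt : Fin (suc m') → ℕ
  nxt i = (toℕ i + 1) % suc m'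
  cadj : Fin (suc m') → Fin (suc m') → Bool
  cadj i j = not (toℕ i ≡ᵇ toℕ j) ∧ ((nxt i ≡ᵇ toℕ j) ∨ (nxt j ≡ᵇ toℕ i))
  csym : ∀ i j → cadj i j ≡ cadj j i
  csym i j rewrite ≡ᵇ-sym (toℕ i) (toℕ j)
                 | ∨-comm (nxt i ≡ᵇ toℕ j) (nxt j ≡ᵇ toℕ i) = refl
  cirr : ∀ i → cadj i i ≡ false
  cirr i rewrite ≡ᵇ-refl (toℕ i) = refl

ProperColouring : ∀ {n} → Graph n → ℕ → Set
ProperColouring {n} G k =
  Σ (Fin n → Fin k) λ c → ∀ u v → T (adj G u v) → c u ≢ c v

IsChromaticNumber : ∀ {n} → Graph n → ℕ → Set
IsChromaticNumber G k =
  ProperColouring G k × (∀ m → ProperColouring G m → k ≤ m)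

-- edges: unordered pairs {i,j} of adjacent vertices, represented by i < j
Edge : ∀ {n} → Graph n → Set
Edge {n} G = Σ (Fin n × Fin n) λ { (i , j) → (i < j) × T (adj G i j) }

incident : ∀ {n} {G : Graph n} → Fin n → Edge G → Bool
incident u ((i , j) , _) = does (u ≟F i) ∨ does (u ≟F j)

-- an edge labeling: a bijection E → {1,…,q} (q = |E|), represented as a
-- bijection E ↔ Fin q, edge e getting label 1 + toℕ (to e).
record EdgeLabeling {n} (G : Graph n) : Set where
  field
    q   : ℕ
    bij : Edge G ↔ Fin q
open EdgeLabeling public

label : ∀ {n} {G : Graph n} (f : EdgeLabeling G) → Edge G → ℕ
label f e = suc (toℕ (Inverse.to (bij f) e))

-- induced vertex sum f⁺(u) = sum of labels of edges incident with u
-- (computed by running through the labels 1..q)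
vsum : ∀ {n} {G : Graph n} (f : EdgeLabeling G) → Fin n → ℕ
vsum {G = G} f u =
  sum (map (λ l → if incident {G = G} u (Inverse.from (bij f) l)
                  then suc (toℕ l) else 0)
           (allFin (q f)))

IsLocalAntimagic : ∀ {n} {G : Graph n} → EdgeLabeling G → Set
IsLocalAntimagic {G = G} f = ∀ u v → T (adj G u v) → vsum f u ≢ vsum f v

numValues : ∀ {n} {G : Graph n} → EdgeLabeling G → ℕ
numValues {n} f = length (deduplicate _≟_ (map (vsum f) (allFin n)))

IsLocalAntimagicChromaticNumber : ∀ {n} → Graph n → ℕ → Set
IsLocalAntimagicChromaticNumber G k =
  (Σ (EdgeLabeling G) λ f → IsLocalAntimagic f × numValues f ≡ k) ×
  (∀ (f : EdgeLabeling G) → IsLocalAntimagic f → k ≤ numValues f)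

iterOrder : ℕ → ℕ → ℕ → ℕ
iterOrder p m zero = p
iterOrder p m (suc k) = iterOrder p m k + m

iterJoin : ∀ {p} → Graph p → (m k : ℕ) → Graph (iterOrder p m k)
iterJoin G m zero = G
iterJoin G m (suc k) = iterJoin G m k ∨G cycle m

{-# OPTIONS --safe #-}
module Submission where

-- The lower bound is χ(G_k) = χ(G) + k χ(C_m), m = p - 2r + 2, since the vertex sums of a local
-- antimagic labeling form a proper colouring.  For the upper bound keep the labels 1, …, q of G_k
-- and give q + 1, q + 2, … to the n m edges between G_k and the new cycle and to the m cycle edges.
-- Write such a label as (n + 1) a + t, where a is a block (0 ≤ a < m) and t a residue: in every row
-- u ∈ G_k the block runs over a permutation of 0, …, m - 1, and for every block a the residue runs
-- over a permutation of the rows.  The permutations can be chosen so that all rows have the same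
-- sum, while the total at a cycle vertex takes only two values (m even) or three (m odd), different
-- at neighbours.  Since 2r + m = p + 2, every vertex of the join has the same degree, and as all new
-- labels exceed all old ones, the new vertices get larger sums than the old ones.
-- For m odd the order of G_k is even for every other k, and then this fails.  Instead G_k is regarded
-- as layers G, C_m, …, C_m: the new C_m is joined to G by the array above and to the earlier cycles by
-- magic squares with increasing labels, so row sums are constant on layers and increase with them.

open import Defs hiding (sym)
open import Algebra.Properties.CommutativeMonoid.Sum using ()
open import Data.Bool using (Bool; true; false; T; T?; if_then_else_; _∨_; not)
open import Data.Bool.Properties using (T-irrelevant; T-∧; T-∨; ∨-identityʳ; ∨-comm; not-involutive)
open import Data.Fin as F using (Fin; zero; suc; toℕ; _↑ˡ_; _↑ʳ_; combine; splitAt; join)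
open import Data.Fin.Induction using (<-weakInduction)
open import Data.Fin.Permutation as Perm using (Permutation; Permutation′; _⟨$⟩ʳ_; _⟨$⟩ˡ_; _∘ₚ_)
import Data.Fin.Properties as FP
open import Data.Fin.Relation.Unary.Top using (view; ‵fromℕ; ‵inject₁)
open import Data.List using (List; []; _∷_; length; filter; map; allFin; tabulate; lookup; deduplicate)
open import Data.List.Membership.Propositional using (_∈_)
open import Data.List.Membership.Propositional.Properties using (∈-map⁺; ∈-map⁻; ∈-allFin; ∈-deduplicate⁺; ∈-deduplicate⁻; ∈-filter⁺; ∈-lookup)
open import Data.List.Properties using (map-tabulate; length-tabulate)
import Data.List.Relation.Unary.All as All
open import Data.List.Relation.Unary.AllPairs using (_∷_)
open import Data.List.Relation.Unary.Any using (index)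
open import Data.List.Relation.Unary.Any.Properties using (lookup-index)
open import Data.List.Relation.Unary.Unique.DecPropositional.Properties using (deduplicate-!)
open import Data.List.Relation.Unary.Unique.Propositional using (Unique)
open import Data.Nat using (ℕ; zero; suc; _+_; _*_; _∸_; _≤_; _<_; _≥_; _≡ᵇ_; z≤n; s≤s; compare; less; equal; greater)
open import Data.Nat.Divisibility using (_∣_; divides; ∣-refl; ∣m+n∣m⇒∣n; ∣m∣n⇒∣m+n; m∣m*n; ∣n⇒∣m*n)
open import Data.Nat.DivMod using (_%_; m%n<n; n%n≡0; m<n⇒m%n≡m; m%n%n≡m%n; %-distribˡ-+; [m+n]%n≡m%n)
import Data.Nat.ListAction as LA
open import Data.Nat.Properties
open import Data.Nat.Tactic.RingSolver using (solve-∀)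
open import Data.Product using (Σ; _×_; _,_; proj₁; proj₂; ∃)
open import Data.Product.Properties using (≡-dec)
open import Data.Sum using (_⊎_; inj₁; inj₂; [_,_]′)
open import Data.Sum.Function.Propositional using (_⊎-↔_)
open import Function using (_∘_; id)
open import Function.Bundles using (_↔_; Equivalence; Inverse; mk↔ₛ′)
open import Function.Construct.Composition using (_↔-∘_)
open import Function.Construct.Identity using (↔-id)
open import Function.Construct.Symmetry using (↔-sym)
open import Relation.Binary.Definitions using (tri<; tri≈; tri>)
open import Relation.Binary.PropositionalEquality using (_≡_; _≢_; refl; sym; trans; cong; cong₂; subst; subst₂; module ≡-Reasoning)
open import Relation.Nullary using (¬_; Dec; yes; no; does; contradiction)
open import Relation.Nullary.Decidable using (dec-true; dec-false; _⊎-dec_; ¬?)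
open import Relation.Unary using (Pred; Decidable)

open Algebra.Properties.CommutativeMonoid.Sum +-0-commutativeMonoid
  using (sum; sum-cong-≗; ∑-distrib-+; ∑-comm; sum-permute)

-- The array has to meet two opposed demands: rows must have equal sums, while columns must have
-- different sums at neighbouring cycle vertices and yet take only χ(C_m) values. Blocks and
-- residues separate the two. The total of the blocks at a cycle vertex, its two cycle edges
-- included, is made constant, so columns differ by their residues alone. A row then has the common
-- sum only if its residues add up to the average m (n - 1) / 2. For m odd and n even this is not an
-- integer, and no array of this shape exists; hence the layers. Rows of different layers may have
-- different sums, because an inequality between the layers keeps their vertex sums apart. For m
-- even, the blocks come in pairs listing the rows in opposite orders, which balances every row. For
-- m odd one block stays unpaired, and three orders of the rows with constant sum are needed; one of
-- them is x ↦ 2x + 1 modulo the odd number n.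

-- Finite sums, indicator sums and degrees

sum-tabulate : ∀ {n} (f : Fin n → ℕ) → LA.sum (tabulate f) ≡ sum f
sum-tabulate {zero}  f = refl
sum-tabulate {suc n} f = cong (f zero +_) (sum-tabulate (f ∘ suc))

sum-map-allFin : ∀ {n} (f : Fin n → ℕ) → LA.sum (map f (allFin n)) ≡ sum f
sum-map-allFin f = trans (cong LA.sum (map-tabulate id f)) (sum-tabulate f)

sum-const : ∀ n x → sum {n} (λ _ → x) ≡ n * x
sum-const zero    x = refl
sum-const (suc n) x = cong (x +_) (sum-const n x)

sum-mono-≤ : ∀ {n} {f g : Fin n → ℕ} → (∀ i → f i ≤ g i) → sum f ≤ sum g
sum-mono-≤ {zero}  f≤g = z≤n
sum-mono-≤ {suc n} f≤g = +-mono-≤ (f≤g zero) (sum-mono-≤ (f≤g ∘ suc))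

sum-mono-< : ∀ {n} {f g : Fin n → ℕ} → (∀ i → f i ≤ g i) → ∀ i → f i < g i → sum f < sum g
sum-mono-< f≤g zero    lt = +-mono-<-≤ lt (sum-mono-≤ (f≤g ∘ suc))
sum-mono-< f≤g (suc i) lt = +-mono-≤-< (f≤g zero) (sum-mono-< (f≤g ∘ suc) i lt)

sum-*ˡ : ∀ {n} c (f : Fin n → ℕ) → sum (λ i → c * f i) ≡ c * sum f
sum-*ˡ {zero}  c f = sym (*-zeroʳ c)
sum-*ˡ {suc n} c f = trans (cong (c * f zero +_) (sum-*ˡ c (f ∘ suc))) (sym (*-distribˡ-+ c _ _))

sum-++ : ∀ a {b} (t : Fin (a + b) → ℕ) → sum t ≡ sum (λ i → t (i ↑ˡ b)) + sum (λ j → t (a ↑ʳ j))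
sum-++ zero    t = refl
sum-++ (suc a) t = trans (cong (t zero +_) (sum-++ a (t ∘ suc))) (sym (+-assoc (t zero) _ _))

sum-combine : ∀ n {m} (t : Fin (n * m) → ℕ) → sum t ≡ sum {n} (λ i → sum {m} (λ j → t (combine i j)))
sum-combine zero    t = refl
sum-combine (suc n) {m} t = trans (sum-++ m t) (cong (sum (λ j → t (j ↑ˡ (n * m))) +_) (sum-combine n (λ j → t (m ↑ʳ j))))

-- Vertex sums run through labels, whereas the construction describes edges; a bijection between the
-- two turns such a sum into a double sum over the array plus a sum over the remaining edges.
sum-reindex : ∀ {n m k N} (A : ((Fin n × Fin m) ⊎ Fin k) ↔ Fin N) (t : Fin N → ℕ) →
  sum t ≡ sum (λ r → sum (λ v → t (Inverse.to A (inj₁ (r , v))))) + sum (λ e → t (Inverse.to A (inj₂ e)))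
sum-reindex {n} {m} {k} A t = begin
  sum t                                                     ≡⟨ sum-permute t π ⟩
  sum (t ∘ Inverse.to π)                                    ≡⟨ sum-++ (n * m) _ ⟩
  sum (λ i → t (Inverse.to π (i ↑ˡ k))) + sum (λ e → t (Inverse.to π ((n * m) ↑ʳ e)))
    ≡⟨ cong₂ _+_ (trans (sum-combine n (λ i → t (Inverse.to π (i ↑ˡ k)))) (sum-cong-≗ λ r → sum-cong-≗ λ v → cong t (cross r v)))
                 (sum-cong-≗ λ e → cong t (top e)) ⟩
  _ ∎
  where
  open ≡-Reasoning
  π : Permutation (n * m + k) _
  π = (A ↔-∘ (FP.*↔× ⊎-↔ ↔-id _)) ↔-∘ FP.+↔⊎
  cross : ∀ r v → Inverse.to π (combine r v ↑ˡ k) ≡ Inverse.to A (inj₁ (r , v))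
  cross r v rewrite FP.splitAt-↑ˡ (n * m) (combine r v) k | FP.remQuot-combine r v = refl
  top : ∀ e → Inverse.to π ((n * m) ↑ʳ e) ≡ Inverse.to A (inj₂ e)
  top e rewrite FP.splitAt-↑ʳ (n * m) k e = refl

infix 8 [_]·_
[_]·_ : Bool → ℕ → ℕ
[ b ]· x = if b then x else 0

sum-false : ∀ {n} (g : Fin n → ℕ) → sum (λ i → [ false ]· g i) ≡ 0
sum-false {n} g = trans (sum-const n 0) (*-zeroʳ n)

sum-single : ∀ {n} (u : Fin n) (g : Fin n → ℕ) → sum (λ i → [ does (u FP.≟ i) ]· g i) ≡ g u
sum-single zero    g = trans (cong (g zero +_) (sum-false (g ∘ suc))) (+-identityʳ _)
sum-single (suc u) g = sum-single u (g ∘ suc)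

sum-indicator : ∀ {n} b (g : Fin n → ℕ) → sum (λ i → [ b ]· g i) ≡ [ b ]· sum g
sum-indicator true  g = refl
sum-indicator false g = sum-false g

length-filter-T : ∀ {a} {A : Set a} (b : A → Bool) (xs : List A) →
  length (filter (λ x → T? (b x)) xs) ≡ LA.sum (map (λ x → [ b x ]· 1) xs)
length-filter-T b []       = refl
length-filter-T b (x ∷ xs) with b x
... | true  = cong suc (length-filter-T b xs)
... | false = length-filter-T b xs

degree-sum : ∀ {n} (G : Graph n) u → degree G u ≡ sum (λ v → [ adj G u v ]· 1)
degree-sum {n} G u = trans (length-filter-T (adj G u) (allFin n)) (sum-map-allFin (λ v → [ adj G u v ]· 1))

-- A vertex is not its own neighbour, so `u` can be counted in addition to its neighbours. The
-- strictness gives p - 2r ≥ 1, so the cycle C_m has at least three vertices.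
degree<order : ∀ {n} (G : Graph n) u → degree G u < n
degree<order {n} G u = begin
  suc (degree G u)                                           ≡⟨ cong suc (degree-sum G u) ⟩
  1 + sum (λ v → [ adj G u v ]· 1)                           ≡⟨ cong (_+ sum (λ v → [ adj G u v ]· 1)) (sum-single u (λ _ → 1)) ⟨
  sum (λ v → [ does (u FP.≟ v) ]· 1) + sum (λ v → [ adj G u v ]· 1) ≡⟨ ∑-distrib-+ (λ v → [ does (u FP.≟ v) ]· 1) _ ⟨
  sum (λ v → [ does (u FP.≟ v) ]· 1 + [ adj G u v ]· 1)      ≤⟨ sum-mono-≤ atMostOne ⟩
  sum {n} (λ _ → 1)                                          ≡⟨ trans (sum-const n 1) (*-identityʳ n) ⟩
  n                                                          ∎
  where
  open ≤-Reasoning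
  atMostOne : ∀ v → [ does (u FP.≟ v) ]· 1 + [ adj G u v ]· 1 ≤ 1
  atMostOne v with u FP.≟ v
  ... | yes refl rewrite irref G u = ≤-refl
  ... | no  _    with adj G u v
  ... | true  = ≤-refl
  ... | false = z≤n

-- Edges and vertex sums of a join

Edge-≡ : ∀ {n} {G : Graph n} {e e′ : Edge G} → proj₁ e ≡ proj₁ e′ → e ≡ e′
Edge-≡ {e = (i , j) , lt , a} {(.i , .j) , lt′ , a′} refl =
  cong₂ (λ x y → (i , j) , x , y) (<-irrelevant lt lt′) (T-irrelevant a a′)

↑ˡ-≟ : ∀ {a} b (i j : Fin a) → does ((i ↑ˡ b) FP.≟ (j ↑ˡ b)) ≡ does (i FP.≟ j)
↑ˡ-≟ b i j with i FP.≟ j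
... | yes i≡j = dec-true (i ↑ˡ b FP.≟ j ↑ˡ b) (cong (_↑ˡ b) i≡j)
... | no  i≢j = dec-false (i ↑ˡ b FP.≟ j ↑ˡ b) (i≢j ∘ FP.↑ˡ-injective b i j)

↑ʳ-≟ : ∀ a {b} (i j : Fin b) → does ((a ↑ʳ i) FP.≟ (a ↑ʳ j)) ≡ does (i FP.≟ j)
↑ʳ-≟ a i j with i FP.≟ j
... | yes i≡j = dec-true (a ↑ʳ i FP.≟ a ↑ʳ j) (cong (a ↑ʳ_) i≡j)
... | no  i≢j = dec-false (a ↑ʳ i FP.≟ a ↑ʳ j) (i≢j ∘ FP.↑ʳ-injective a i j)

↑ˡ≢↑ʳ : ∀ {a b} (i : Fin a) (j : Fin b) → i ↑ˡ b ≢ a ↑ʳ j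
↑ˡ≢↑ʳ {a} {b} i j eq with () ← trans (sym (FP.splitAt-↑ˡ a i b)) (trans (cong (splitAt a) eq) (FP.splitAt-↑ʳ a b j))

↑ˡ-↑ʳ-≟ : ∀ {a b} (i : Fin a) (j : Fin b) → does ((i ↑ˡ b) FP.≟ (a ↑ʳ j)) ≡ false
↑ˡ-↑ʳ-≟ {a} {b} i j = dec-false (i ↑ˡ b FP.≟ a ↑ʳ j) (↑ˡ≢↑ʳ i j)

↑ʳ-↑ˡ-≟ : ∀ {a b} (j : Fin b) (i : Fin a) → does ((a ↑ʳ j) FP.≟ (i ↑ˡ b)) ≡ false
↑ʳ-↑ˡ-≟ {a} {b} j i = dec-false (a ↑ʳ j FP.≟ i ↑ˡ b) (↑ˡ≢↑ʳ i j ∘ sym)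

↑ʳ≮↑ˡ : ∀ {a b} (i : Fin b) (j : Fin a) → ¬ toℕ (a ↑ʳ i) < toℕ (j ↑ˡ b)
↑ʳ≮↑ˡ {a} {b} i j = <-asym (begin-strict
  toℕ (j ↑ˡ b)  ≡⟨ FP.toℕ-↑ˡ j b ⟩
  toℕ j         <⟨ FP.toℕ<n j ⟩
  a             ≤⟨ m≤m+n a (toℕ i) ⟩
  a + toℕ i     ≡⟨ FP.toℕ-↑ʳ a i ⟨
  toℕ (a ↑ʳ i)  ∎)
  where open ≤-Reasoning

module _ {a b} (G : Graph a) (H : Graph b) where

  JoinEdge : Set
  JoinEdge = Edge G ⊎ ((Fin a × Fin b) ⊎ Edge H)

  private
    -- The order hypothesis speaks of `join a b s`, so that matching on `s` and `t` refines it. As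
    -- an edge lists its smaller end first, a cross edge always starts in `G`.
    classify : (s t : Fin a ⊎ Fin b) → toℕ (join a b s) < toℕ (join a b t) → T (joinAdj G H s t) → JoinEdge
    classify (inj₁ i) (inj₁ j) lt e =
      inj₁ ((i , j) , subst₂ _<_ (FP.toℕ-↑ˡ i b) (FP.toℕ-↑ˡ j b) lt , e)
    classify (inj₁ i) (inj₂ j) lt e = inj₂ (inj₁ (i , j))
    classify (inj₂ i) (inj₁ j) lt e = contradiction lt (↑ʳ≮↑ˡ i j)
    classify (inj₂ i) (inj₂ j) lt e =
      inj₂ (inj₂ ((i , j) , +-cancelˡ-< a _ _ (subst₂ _<_ (FP.toℕ-↑ʳ a i) (FP.toℕ-↑ʳ a j) lt) , e))

  splitEdge : Edge (G ∨G H) → JoinEdge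
  splitEdge ((x , y) , lt , e) = classify (splitAt a x) (splitAt a y)
    (subst₂ (λ p q → toℕ p < toℕ q) (sym (FP.join-splitAt a b x)) (sym (FP.join-splitAt a b y)) lt) e

  joinEdge : JoinEdge → Edge (G ∨G H)
  joinEdge (inj₁ ((i , j) , lt , e)) = (i ↑ˡ b , j ↑ˡ b) ,
    subst₂ _<_ (sym (FP.toℕ-↑ˡ i b)) (sym (FP.toℕ-↑ˡ j b)) lt ,
    subst₂ (λ s t → T (joinAdj G H s t)) (sym (FP.splitAt-↑ˡ a i b)) (sym (FP.splitAt-↑ˡ a j b)) e
  joinEdge (inj₂ (inj₁ (i , j))) = (i ↑ˡ b , a ↑ʳ j) ,
    subst₂ _<_ (sym (FP.toℕ-↑ˡ i b)) (sym (FP.toℕ-↑ʳ a j)) (≤-trans (FP.toℕ<n i) (m≤m+n a (toℕ j))) ,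
    subst₂ (λ s t → T (joinAdj G H s t)) (sym (FP.splitAt-↑ˡ a i b)) (sym (FP.splitAt-↑ʳ a b j)) _
  joinEdge (inj₂ (inj₂ ((i , j) , lt , e))) = (a ↑ʳ i , a ↑ʳ j) ,
    subst₂ _<_ (sym (FP.toℕ-↑ʳ a i)) (sym (FP.toℕ-↑ʳ a j)) (+-monoʳ-< a lt) ,
    subst₂ (λ s t → T (joinAdj G H s t)) (sym (FP.splitAt-↑ʳ a b i)) (sym (FP.splitAt-↑ʳ a b j)) e

  private
    joinEdge-classify : ∀ s t lt e → proj₁ (joinEdge (classify s t lt e)) ≡ (join a b s , join a b t)
    joinEdge-classify (inj₁ i) (inj₁ j) lt e = refl
    joinEdge-classify (inj₁ i) (inj₂ j) lt e = refl
    joinEdge-classify (inj₂ i) (inj₁ j) lt e = contradiction lt (↑ʳ≮↑ˡ i j)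
    joinEdge-classify (inj₂ i) (inj₂ j) lt e = refl

    classify-inj₁ : ∀ s t lt e (ε : Edge G) → s ≡ inj₁ (proj₁ (proj₁ ε)) → t ≡ inj₁ (proj₂ (proj₁ ε)) →
      classify s t lt e ≡ inj₁ ε
    classify-inj₁ _ _ lt e ε refl refl = cong inj₁ (Edge-≡ {G = G} refl)

    classify-cross : ∀ s t lt e i j → s ≡ inj₁ i → t ≡ inj₂ j → classify s t lt e ≡ inj₂ (inj₁ (i , j))
    classify-cross _ _ lt e i j refl refl = refl

    classify-inj₂ : ∀ s t lt e (ε : Edge H) → s ≡ inj₂ (proj₁ (proj₁ ε)) → t ≡ inj₂ (proj₂ (proj₁ ε)) →
      classify s t lt e ≡ inj₂ (inj₂ ε)
    classify-inj₂ _ _ lt e ε refl refl = cong (inj₂ ∘ inj₂) (Edge-≡ {G = H} refl)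

  joinEdge-splitEdge : ∀ e → joinEdge (splitEdge e) ≡ e
  joinEdge-splitEdge ((x , y) , lt , e) = Edge-≡ {G = G ∨G H} (trans
    (joinEdge-classify (splitAt a x) (splitAt a y) _ e)
    (cong₂ _,_ (FP.join-splitAt a b x) (FP.join-splitAt a b y)))

  splitEdge-joinEdge : ∀ e → splitEdge (joinEdge e) ≡ e
  splitEdge-joinEdge (inj₁ ε@((i , j) , _)) =
    classify-inj₁ _ _ _ _ ε (FP.splitAt-↑ˡ a i b) (FP.splitAt-↑ˡ a j b)
  splitEdge-joinEdge (inj₂ (inj₁ (i , j))) =
    classify-cross _ _ _ _ i j (FP.splitAt-↑ˡ a i b) (FP.splitAt-↑ʳ a b j)
  splitEdge-joinEdge (inj₂ (inj₂ ε@((i , j) , _))) =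
    classify-inj₂ _ _ _ _ ε (FP.splitAt-↑ʳ a b i) (FP.splitAt-↑ʳ a b j)

  joinEdges↔ : Edge (G ∨G H) ↔ JoinEdge
  joinEdges↔ = mk↔ₛ′ splitEdge joinEdge splitEdge-joinEdge joinEdge-splitEdge

  incidentˡ : Fin a → JoinEdge → Bool
  incidentˡ u (inj₁ e)              = incident {G = G} u e
  incidentˡ u (inj₂ (inj₁ (i , _))) = does (u FP.≟ i)
  incidentˡ u (inj₂ (inj₂ _))       = false

  incidentʳ : Fin b → JoinEdge → Bool
  incidentʳ v (inj₁ _)              = false
  incidentʳ v (inj₂ (inj₁ (_ , j))) = does (v FP.≟ j)
  incidentʳ v (inj₂ (inj₂ e))       = incident {G = H} v e

  incident-joinˡ : ∀ u e → incident {G = G ∨G H} (u ↑ˡ b) (joinEdge e) ≡ incidentˡ u e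
  incident-joinˡ u (inj₁ ((i , j) , _))        = cong₂ _∨_ (↑ˡ-≟ b u i) (↑ˡ-≟ b u j)
  incident-joinˡ u (inj₂ (inj₁ (i , j)))       = trans (cong₂ _∨_ (↑ˡ-≟ b u i) (↑ˡ-↑ʳ-≟ u j)) (∨-identityʳ _)
  incident-joinˡ u (inj₂ (inj₂ ((i , j) , _))) = cong₂ _∨_ (↑ˡ-↑ʳ-≟ u i) (↑ˡ-↑ʳ-≟ u j)

  incident-joinʳ : ∀ v e → incident {G = G ∨G H} (a ↑ʳ v) (joinEdge e) ≡ incidentʳ v e
  incident-joinʳ v (inj₁ ((i , j) , _))        = cong₂ _∨_ (↑ʳ-↑ˡ-≟ v i) (↑ʳ-↑ˡ-≟ v j)
  incident-joinʳ v (inj₂ (inj₁ (i , j)))       = cong₂ _∨_ (↑ʳ-↑ˡ-≟ v i) (↑ʳ-≟ a v j)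
  incident-joinʳ v (inj₂ (inj₂ ((i , j) , _))) = cong₂ _∨_ (↑ʳ-≟ a v i) (↑ʳ-≟ a v j)

  degree-joinˡ : ∀ u → degree (G ∨G H) (u ↑ˡ b) ≡ degree G u + b
  degree-joinˡ u = begin
    degree (G ∨G H) (u ↑ˡ b)  ≡⟨ degree-sum (G ∨G H) (u ↑ˡ b) ⟩
    sum (λ w → [ adj (G ∨G H) (u ↑ˡ b) w ]· 1)  ≡⟨ sum-++ a _ ⟩
    _  ≡⟨ cong₂ _+_ (sum-cong-≗ λ w → cong ([_]· 1) (cong₂ (joinAdj G H) (FP.splitAt-↑ˡ a u b) (FP.splitAt-↑ˡ a w b)))
                    (sum-cong-≗ λ w → cong ([_]· 1) (cong₂ (joinAdj G H) (FP.splitAt-↑ˡ a u b) (FP.splitAt-↑ʳ a b w))) ⟩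
    sum (λ w → [ adj G u w ]· 1) + sum {b} (λ _ → 1)
      ≡⟨ cong₂ _+_ (sym (degree-sum G u)) (trans (sum-const b 1) (*-identityʳ b)) ⟩
    degree G u + b  ∎
    where open ≡-Reasoning

  degree-joinʳ : ∀ v → degree (G ∨G H) (a ↑ʳ v) ≡ a + degree H v
  degree-joinʳ v = begin
    degree (G ∨G H) (a ↑ʳ v)  ≡⟨ degree-sum (G ∨G H) (a ↑ʳ v) ⟩
    sum (λ w → [ adj (G ∨G H) (a ↑ʳ v) w ]· 1)  ≡⟨ sum-++ a _ ⟩
    _  ≡⟨ cong₂ _+_ (sum-cong-≗ λ w → cong ([_]· 1) (cong₂ (joinAdj G H) (FP.splitAt-↑ʳ a b v) (FP.splitAt-↑ˡ a w b)))
                    (sum-cong-≗ λ w → cong ([_]· 1) (cong₂ (joinAdj G H) (FP.splitAt-↑ʳ a b v) (FP.splitAt-↑ʳ a b w))) ⟩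
    sum {a} (λ _ → 1) + sum (λ w → [ adj H v w ]· 1)
      ≡⟨ cong₂ _+_ (trans (sum-const a 1) (*-identityʳ a)) (sym (degree-sum H v)) ⟩
    a + degree H v  ∎
    where open ≡-Reasoning

  module _ (f : EdgeLabeling G) {k} (ε : Edge H ↔ Fin k) {N} (A : ((Fin a × Fin b) ⊎ Fin k) ↔ Fin N) where

    joinLabeling : EdgeLabeling (G ∨G H)
    joinLabeling = record
      { q   = q f + N
      ; bij = (↔-sym FP.+↔⊎ ↔-∘ (bij f ⊎-↔ (A ↔-∘ (↔-id _ ⊎-↔ ε)))) ↔-∘ joinEdges↔
      }

    private
      f′ = joinLabeling

      newEdge : (Fin a × Fin b) ⊎ Fin k → JoinEdge
      newEdge (inj₁ uv) = inj₂ (inj₁ uv)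
      newEdge (inj₂ e)  = inj₂ (inj₂ (Inverse.from ε e))

      from-old : ∀ l → Inverse.from (bij f′) (l ↑ˡ N) ≡ joinEdge (inj₁ (Inverse.from (bij f) l))
      from-old l rewrite FP.splitAt-↑ˡ (q f) l N = refl

      from-new : ∀ x → Inverse.from (bij f′) (q f ↑ʳ Inverse.to A x) ≡ joinEdge (newEdge x)
      from-new x rewrite FP.splitAt-↑ʳ (q f) N (Inverse.to A x) | Inverse.strictlyInverseʳ A x with x
      ... | inj₁ _ = refl
      ... | inj₂ _ = refl

    newLabel : (Fin a × Fin b) ⊎ Fin k → ℕ
    newLabel x = suc (q f + toℕ (Inverse.to A x))

    private
      vsum-split : ∀ w → vsum f′ w ≡
        sum (λ l → [ incident {G = G ∨G H} w (joinEdge (inj₁ (Inverse.from (bij f) l))) ]· suc (toℕ l)) +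
        (sum (λ r → sum (λ v → [ incident {G = G ∨G H} w (joinEdge (inj₂ (inj₁ (r , v)))) ]· newLabel (inj₁ (r , v)))) +
         sum (λ e → [ incident {G = G ∨G H} w (joinEdge (inj₂ (inj₂ (Inverse.from ε e)))) ]· newLabel (inj₂ e)))
      vsum-split w = begin
        vsum f′ w  ≡⟨ sum-map-allFin term ⟩
        sum term   ≡⟨ sum-++ (q f) term ⟩
        sum (λ l → term (l ↑ˡ N)) + sum (λ x → term (q f ↑ʳ x))
          ≡⟨ cong (sum (λ l → term (l ↑ˡ N)) +_) (sum-reindex A (λ x → term (q f ↑ʳ x))) ⟩
        _ ≡⟨ cong₂ _+_ (sum-cong-≗ λ l → cong₂ (λ e y → [ incident {G = G ∨G H} w e ]· suc y) (from-old l) (FP.toℕ-↑ˡ l N))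
              (cong₂ _+_ (sum-cong-≗ λ r → sum-cong-≗ λ v → new (inj₁ (r , v))) (sum-cong-≗ λ e → new (inj₂ e))) ⟩
        _ ∎
        where
        open ≡-Reasoning
        term : Fin (q f + N) → ℕ
        term l = [ incident {G = G ∨G H} w (Inverse.from (bij f′) l) ]· suc (toℕ l)
        new : ∀ x → term (q f ↑ʳ Inverse.to A x) ≡ [ incident {G = G ∨G H} w (joinEdge (newEdge x)) ]· newLabel x
        new x = cong₂ (λ e y → [ incident {G = G ∨G H} w e ]· suc y) (from-new x) (FP.toℕ-↑ʳ (q f) (Inverse.to A x))

    vsum-joinˡ : ∀ u → vsum f′ (u ↑ˡ b) ≡ vsum f u + sum (λ v → newLabel (inj₁ (u , v)))
    vsum-joinˡ u = trans (vsum-split (u ↑ˡ b)) (cong₂ _+_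
      (trans (sum-cong-≗ λ l → cong ([_]· suc (toℕ l)) (incident-joinˡ u (inj₁ (Inverse.from (bij f) l))))
             (sym (sum-map-allFin (λ l → [ incident {G = G} u (Inverse.from (bij f) l) ]· suc (toℕ l)))))
      (trans (cong₂ _+_
        (trans (sum-cong-≗ λ r → trans
                  (sum-cong-≗ λ v → cong ([_]· newLabel (inj₁ (r , v))) (incident-joinˡ u (inj₂ (inj₁ (r , v)))))
                  (sum-indicator (does (u FP.≟ r)) (λ v → newLabel (inj₁ (r , v)))))
               (sum-single u (λ r → sum (λ v → newLabel (inj₁ (r , v))))))
        (trans (sum-cong-≗ λ e → cong ([_]· newLabel (inj₂ e)) (incident-joinˡ u (inj₂ (inj₂ (Inverse.from ε e)))))
               (sum-false {k} (λ e → newLabel (inj₂ e)))))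
        (+-identityʳ _)))

    vsum-joinʳ : ∀ v → vsum f′ (a ↑ʳ v) ≡
      sum (λ r → newLabel (inj₁ (r , v))) + sum (λ e → [ incident {G = H} v (Inverse.from ε e) ]· newLabel (inj₂ e))
    vsum-joinʳ v = trans (vsum-split (a ↑ʳ v)) (cong₂ _+_
      (trans (sum-cong-≗ λ l → cong ([_]· suc (toℕ l)) (incident-joinʳ v (inj₁ (Inverse.from (bij f) l))))
             (sum-false {q f} (λ l → suc (toℕ l))))
      (cong₂ _+_
        (sum-cong-≗ λ r → trans
          (sum-cong-≗ λ w → cong ([_]· newLabel (inj₁ (r , w))) (incident-joinʳ v (inj₂ (inj₁ (r , w)))))
          (sum-single v (λ w → newLabel (inj₁ (r , w)))))
        (sum-cong-≗ λ e → cong ([_]· newLabel (inj₂ e)) (incident-joinʳ v (inj₂ (inj₂ (Inverse.from ε e)))))))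

-- Vertex sums are bounded by degree times number of edges

term≤sum : ∀ {n} (t : Fin n → ℕ) i → t i ≤ sum t
term≤sum t zero    = m≤m+n _ _
term≤sum t (suc i) = ≤-trans (term≤sum (t ∘ suc) i) (m≤n+m _ _)

-- At most one term is nonzero, and if there is one, `c` holds. It is applied to the labels joining
-- two fixed vertices, with `c` their adjacency.
sum-unique-≤ : ∀ {n} (b : Fin n → Bool) c x → (∀ i j → T (b i) → T (b j) → i ≡ j) → (∀ i → T (b i) → T c) →
  sum (λ i → [ b i ]· x) ≤ [ c ]· x
sum-unique-≤ {zero}  b c x unique impl = z≤n
sum-unique-≤ {suc n} b c x unique impl with b zero in eq
... | false = sum-unique-≤ (b ∘ suc) c x (λ i j p q → FP.suc-injective (unique (suc i) (suc j) p q)) (impl ∘ suc)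
... | true  = begin
  x + sum (λ i → [ b (suc i) ]· x)      ≡⟨ cong (x +_) (sum-cong-≗ λ i → cong ([_]· x) (rest i)) ⟩
  x + sum {n} (λ i → [ false ]· x)      ≡⟨ cong (x +_) (sum-false {n} (λ _ → x)) ⟩
  x + 0                                 ≡⟨ +-identityʳ x ⟩
  x                                     ≤⟨ holds c (impl zero (subst T (sym eq) _)) ⟩
  [ c ]· x                              ∎
  where
  open ≤-Reasoning
  rest : ∀ i → b (suc i) ≡ false
  rest i with b (suc i) in eq′
  ... | false = refl
  ... | true  with () ← unique zero (suc i) (subst T (sym eq) _) (subst T (sym eq′) _)
  holds : ∀ c → T c → x ≤ [ c ]· x
  holds true _ = ≤-refl

T-does : ∀ {p} {P : Set p} (d : Dec P) → T (does d) → P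
T-does (yes p) _ = p

does-T : ∀ {p} {P : Set p} (d : Dec P) → P → T (does d)
does-T d p = subst T (sym (dec-true d p)) _

bool≡does : ∀ {p} {P : Set p} (b : Bool) (d : Dec P) → (T b → P) → (P → T b) → b ≡ does d
bool≡does true  d to from = sym (dec-true d (to _))
bool≡does false d to from = sym (dec-false d from)

-- Each label at `u` is at most `q f` and is charged to the other end of its edge. After exchanging
-- the sums, every neighbour is charged once, since a pair of vertices carries at most one edge.
vsum≤degree*q : ∀ {n} {G : Graph n} (f : EdgeLabeling G) u → vsum f u ≤ degree G u * q f
vsum≤degree*q {n} {G} f u = begin
  vsum f u                                                      ≡⟨ sum-map-allFin {q f} (λ l → [ incident {G = G} u (edge l) ]· suc (toℕ l)) ⟩
  sum (λ l → [ incident {G = G} u (edge l) ]· suc (toℕ l))      ≤⟨ sum-mono-≤ other ⟩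
  sum (λ l → sum (λ v → [ does (links l v) ]· q f))             ≡⟨ ∑-comm (λ l v → [ does (links l v) ]· q f) ⟩
  sum (λ v → sum (λ l → [ does (links l v) ]· q f))             ≤⟨ sum-mono-≤ (λ v → sum-unique-≤ (λ l → does (links l v)) (adj G u v) (q f) (unique v) (adjacent v)) ⟩
  sum (λ v → [ adj G u v ]· q f)                                ≡⟨ sum-cong-≗ (λ v → scale (adj G u v)) ⟩
  sum (λ v → q f * [ adj G u v ]· 1)                            ≡⟨ sum-*ˡ (q f) (λ v → [ adj G u v ]· 1) ⟩
  q f * sum (λ v → [ adj G u v ]· 1)                            ≡⟨ *-comm (q f) _ ⟩
  sum (λ v → [ adj G u v ]· 1) * q f                            ≡⟨ cong (_* q f) (degree-sum G u) ⟨
  degree G u * q f                                              ∎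
  where
  open ≤-Reasoning
  edge : Fin (q f) → Edge G
  edge = Inverse.from (bij f)
  links : ∀ l v → Dec (proj₁ (edge l) ≡ (u , v) ⊎ proj₁ (edge l) ≡ (v , u))
  links l v = ≡-dec FP._≟_ FP._≟_ (proj₁ (edge l)) (u , v) ⊎-dec ≡-dec FP._≟_ FP._≟_ (proj₁ (edge l)) (v , u)
  scale : ∀ b → [ b ]· q f ≡ q f * [ b ]· 1
  scale true  = sym (*-identityʳ (q f))
  scale false = sym (*-zeroʳ (q f))
  other : ∀ l → [ incident {G = G} u (edge l) ]· suc (toℕ l) ≤ sum (λ v → [ does (links l v) ]· q f)
  other l = go _ refl
    where
    found : ∀ v → proj₁ (edge l) ≡ (u , v) ⊎ proj₁ (edge l) ≡ (v , u) → suc (toℕ l) ≤ sum (λ v → [ does (links l v) ]· q f)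
    found v p = begin
      suc (toℕ l)                             ≤⟨ FP.toℕ<n l ⟩
      q f                                     ≡⟨ cong ([_]· q f) (dec-true (links l v) p) ⟨
      [ does (links l v) ]· q f               ≤⟨ term≤sum (λ v → [ does (links l v) ]· q f) v ⟩
      sum (λ v → [ does (links l v) ]· q f)   ∎
    go : ∀ b → incident {G = G} u (edge l) ≡ b → [ b ]· suc (toℕ l) ≤ sum (λ v → [ does (links l v) ]· q f)
    go false _  = z≤n
    go true  eq with u FP.≟ proj₁ (proj₁ (edge l)) | u FP.≟ proj₂ (proj₁ (edge l))
    ... | yes refl | _        = found (proj₂ (proj₁ (edge l))) (inj₁ refl)
    ... | no  _    | yes refl = found (proj₁ (proj₁ (edge l))) (inj₂ refl)
  ordered : ∀ l {v w} → proj₁ (edge l) ≡ (v , w) → v F.< w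
  ordered l refl = proj₁ (proj₂ (edge l))
  edge-injective : ∀ l l′ → proj₁ (edge l) ≡ proj₁ (edge l′) → l ≡ l′
  edge-injective l l′ eq = trans (sym (Inverse.strictlyInverseˡ (bij f) l))
    (trans (cong (Inverse.to (bij f)) (Edge-≡ {G = G} eq)) (Inverse.strictlyInverseˡ (bij f) l′))
  unique : ∀ v l l′ → T (does (links l v)) → T (does (links l′ v)) → l ≡ l′
  unique v l l′ p p′ with T-does (links l v) p | T-does (links l′ v) p′
  ... | inj₁ x | inj₁ y = edge-injective l l′ (trans x (sym y))
  ... | inj₂ x | inj₂ y = edge-injective l l′ (trans x (sym y))
  ... | inj₁ x | inj₂ y = contradiction (ordered l x) (<-asym (ordered l′ y))
  ... | inj₂ x | inj₁ y = contradiction (ordered l x) (<-asym (ordered l′ y))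
  isEdge : ∀ l {v w} → proj₁ (edge l) ≡ (v , w) → T (adj G v w)
  isEdge l refl = proj₂ (proj₂ (edge l))
  adjacent : ∀ v l → T (does (links l v)) → T (adj G u v)
  adjacent v l p with T-does (links l v) p
  ... | inj₁ x = isEdge l x
  ... | inj₂ x = subst T (Graph.sym G v u) (isEdge l x)

-- The cycle: neighbours, degrees and edges

prev : ∀ {n} → Fin (suc n) → Fin (suc n)
prev {n} zero    = F.fromℕ n
prev     (suc i) = F.inject₁ i

-- Given by the same remainder as the adjacency of `cycle`, whereas `prev` computes by matching. A
-- case split with `view` writes any vertex as a `prev`, which makes `next` computable as well.
next : ∀ {n} → Fin (suc n) → Fin (suc n)
next {n} i = F.fromℕ< (m%n<n (toℕ i + 1) (suc n))

toℕ-next : ∀ {n} (i : Fin (suc n)) → toℕ (next i) ≡ (toℕ i + 1) % suc n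
toℕ-next {n} i = FP.toℕ-fromℕ< (m%n<n (toℕ i + 1) (suc n))

next-prev : ∀ {n} (i : Fin (suc n)) → next (prev i) ≡ i
next-prev {n} zero = FP.toℕ-injective (begin
  toℕ (next (F.fromℕ n))            ≡⟨ toℕ-next (F.fromℕ n) ⟩
  (toℕ (F.fromℕ n) + 1) % suc n     ≡⟨ cong (_% suc n) (trans (+-comm _ 1) (cong suc (FP.toℕ-fromℕ n))) ⟩
  suc n % suc n                     ≡⟨ n%n≡0 (suc n) ⟩
  0                                 ∎)
  where open ≡-Reasoning
next-prev {n} (suc i) = FP.toℕ-injective (begin
  toℕ (next (F.inject₁ i))          ≡⟨ toℕ-next (F.inject₁ i) ⟩
  (toℕ (F.inject₁ i) + 1) % suc n   ≡⟨ cong (_% suc n) (trans (+-comm _ 1) (cong suc (FP.toℕ-inject₁ i))) ⟩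
  suc (toℕ i) % suc n               ≡⟨ m<n⇒m%n≡m (s≤s (FP.toℕ<n i)) ⟩
  suc (toℕ i)                       ∎)
  where open ≡-Reasoning

prev-next : ∀ {n} (i : Fin (suc n)) → prev (next i) ≡ i
prev-next i with view i
... | ‵fromℕ     = cong prev (next-prev zero)
... | ‵inject₁ j = cong prev (next-prev (suc j))

prev≢ : ∀ {n} (i : Fin (suc (suc n))) → prev i ≢ i
prev≢ (suc i) eq = 1+n≢n (trans (sym (cong toℕ eq)) (FP.toℕ-inject₁ i))

next≢ : ∀ {n} (i : Fin (suc (suc n))) → next i ≢ i
next≢ i eq = prev≢ i (trans (cong prev (sym eq)) (prev-next i))

-- On two vertices the successor and the predecessor coincide; from three on, two steps back never
-- return to the start. This is what makes the degree 2.
next≢prev : ∀ {n} (i : Fin (suc (suc (suc n)))) → next i ≢ prev i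
next≢prev i eq = lemma i (trans (cong prev (sym eq)) (prev-next i))
  where
  lemma : ∀ {n} (i : Fin (suc (suc (suc n)))) → prev (prev i) ≢ i
  lemma (suc (suc i)) eq = <⇒≢ (s≤s (n≤1+n (toℕ i))) (trans (sym
    (trans (FP.toℕ-inject₁ (F.inject₁ i)) (FP.toℕ-inject₁ i))) (cong toℕ eq))

adj-cycle : ∀ {n} (i j : Fin (suc (suc n))) →
  adj (cycle (suc (suc n))) i j ≡ does (next i FP.≟ j) ∨ does (prev i FP.≟ j)
adj-cycle {n} i j = bool≡does (adj (cycle (suc (suc n))) i j) (next i FP.≟ j ⊎-dec prev i FP.≟ j) to from
  where
  to : T (adj (cycle (suc (suc n))) i j) → next i ≡ j ⊎ prev i ≡ j
  to p with Equivalence.to T-∨ (proj₂ (Equivalence.to T-∧ p))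
  ... | inj₁ x = inj₁ (FP.toℕ-injective (trans (toℕ-next i) (≡ᵇ⇒≡ _ _ x)))
  ... | inj₂ x = inj₂ (trans (cong prev (sym (FP.toℕ-injective (trans (toℕ-next j) (≡ᵇ⇒≡ _ _ x))))) (prev-next j))
  distinct : i ≢ j → T (not (toℕ i ≡ᵇ toℕ j))
  distinct i≢j with toℕ i ≡ᵇ toℕ j in eq
  ... | false = _
  ... | true  = i≢j (FP.toℕ-injective (≡ᵇ⇒≡ _ _ (subst T (sym eq) _)))
  from : next i ≡ j ⊎ prev i ≡ j → T (adj (cycle (suc (suc n))) i j)
  from (inj₁ refl) = Equivalence.from T-∧ (distinct (next≢ i ∘ sym) ,
    Equivalence.from T-∨ (inj₁ (≡⇒≡ᵇ _ _ (sym (toℕ-next i)))))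
  from (inj₂ refl) = Equivalence.from T-∧ (distinct (prev≢ i ∘ sym) ,
    Equivalence.from T-∨ (inj₂ (≡⇒≡ᵇ _ _ (trans (sym (toℕ-next (prev i))) (cong toℕ (next-prev i))))))

adj-next : ∀ {n} (i : Fin (suc (suc n))) → T (adj (cycle (suc (suc n))) i (next i))
adj-next i = subst T (sym (adj-cycle i (next i))) (Equivalence.from T-∨ (inj₁ (does-T (next i FP.≟ next i) refl)))

adj-prev : ∀ {n} (i : Fin (suc (suc n))) → T (adj (cycle (suc (suc n))) i (prev i))
adj-prev i = subst T (sym (adj-cycle i (prev i)))
  (Equivalence.from (T-∨ {does (next i FP.≟ prev i)}) (inj₂ (does-T (prev i FP.≟ prev i) refl)))

adj-cycle⁻ : ∀ {n} {i j : Fin (suc (suc n))} → T (adj (cycle (suc (suc n))) i j) → next i ≡ j ⊎ next j ≡ i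
adj-cycle⁻ {n} {i} {j} p with T-does (next i FP.≟ j ⊎-dec prev i FP.≟ j) (subst T (adj-cycle i j) p)
... | inj₁ x = inj₁ x
... | inj₂ refl = inj₂ (next-prev i)

sum-pair : ∀ {n} {u v : Fin n} (g : Fin n → ℕ) → u ≢ v →
  sum (λ i → [ does (u FP.≟ i) ∨ does (v FP.≟ i) ]· g i) ≡ g u + g v
sum-pair {n} {u} {v} g u≢v = trans (sum-cong-≗ split) (trans
  (∑-distrib-+ (λ i → [ does (u FP.≟ i) ]· g i) (λ i → [ does (v FP.≟ i) ]· g i))
  (cong₂ _+_ (sum-single u g) (sum-single v g)))
  where
  split : ∀ i → [ does (u FP.≟ i) ∨ does (v FP.≟ i) ]· g i ≡ [ does (u FP.≟ i) ]· g i + [ does (v FP.≟ i) ]· g i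
  split i with u FP.≟ i
  ... | no  _    = refl
  ... | yes refl rewrite dec-false (v FP.≟ u) (u≢v ∘ sym) = sym (+-identityʳ (g u))

cycle-regular : ∀ n → IsRegular (cycle (suc (suc (suc n)))) 2
cycle-regular n v = trans (degree-sum (cycle (suc (suc (suc n)))) v)
  (trans (sum-cong-≗ λ w → cong ([_]· 1) (adj-cycle v w)) (sum-pair (λ _ → 1) (next≢prev v)))

-- Edge k of the cycle joins vertices k - 1 and k (mod m).
cycleEdge : ∀ {n} → Fin (suc (suc n)) → Edge (cycle (suc (suc n)))
cycleEdge {n} zero    = (zero , F.fromℕ (suc n)) , s≤s z≤n , adj-prev {n} zero
cycleEdge {n} (suc i) = (F.inject₁ i , suc i) , s≤s (≤-reflexive (FP.toℕ-inject₁ i)) ,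
  subst (λ j → T (adj (cycle _) (F.inject₁ i) j)) (next-prev (suc i)) (adj-next (F.inject₁ i))

-- Only edges 0 and 1 share their first end, the vertex 0; they differ because with three or more
-- vertices the last vertex is not vertex 1.
cycleEdge-injective : ∀ {n} (k l : Fin (suc (suc (suc n)))) → cycleEdge k ≡ cycleEdge l → k ≡ l
cycleEdge-injective zero    zero    eq = refl
cycleEdge-injective (suc k) (suc l) eq = cong (proj₂ ∘ proj₁) eq
cycleEdge-injective zero (suc zero) eq with () ← cong (proj₂ ∘ proj₁) eq
cycleEdge-injective (suc zero) zero eq with () ← cong (proj₂ ∘ proj₁) eq

-- If the larger end follows the smaller one, it is the index of the edge. If the smaller end
-- follows the larger one, it must be 0, and the edge is the one that wraps around.
cycleEdge-surjective : ∀ {n} (e : Edge (cycle (suc (suc n)))) → ∃ λ k → cycleEdge k ≡ e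
cycleEdge-surjective {n} ((i , suc j) , lt , a) with adj-cycle⁻ {i = i} {suc j} a
... | inj₁ x = suc j , Edge-≡ {G = cycle (suc (suc n))} (cong (_, suc j) (trans (cong prev (sym x)) (prev-next i)))
cycleEdge-surjective {n} ((zero , suc j) , lt , a) | inj₂ x =
  zero , Edge-≡ {G = cycle (suc (suc n))} (cong (zero ,_) (trans (cong prev (sym x)) (prev-next (suc j))))
cycleEdge-surjective {n} ((suc i , suc j) , lt , a) | inj₂ x = contradiction lt (<-asym (begin-strict
  suc (toℕ j)         ≡⟨ cong toℕ (trans (sym (prev-next (suc j))) (cong prev x)) ⟩
  toℕ (F.inject₁ i)   ≡⟨ FP.toℕ-inject₁ i ⟩
  toℕ i               <⟨ n<1+n (toℕ i) ⟩
  suc (toℕ i)         ∎))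
  where open ≤-Reasoning

cycleEdges↔ : ∀ n → Edge (cycle (suc (suc (suc n)))) ↔ Fin (suc (suc (suc n)))
cycleEdges↔ n = mk↔ₛ′ (proj₁ ∘ cycleEdge-surjective) cycleEdge
  (λ k → cycleEdge-injective _ k (proj₂ (cycleEdge-surjective (cycleEdge k))))
  (proj₂ ∘ cycleEdge-surjective)

incident-cycleEdge : ∀ {n} (v k : Fin (suc (suc n))) →
  incident {G = cycle (suc (suc n))} v (cycleEdge k) ≡ does (v FP.≟ k) ∨ does (next v FP.≟ k)
incident-cycleEdge v k = trans (endpoints k) (bool≡does (does (v FP.≟ k) ∨ does (v FP.≟ prev k)) (v FP.≟ k ⊎-dec next v FP.≟ k)
  (λ p → [ inj₁ , (λ { refl → inj₂ (next-prev k) }) ]′ (T-does (v FP.≟ k ⊎-dec v FP.≟ prev k) p))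
  (λ p → does-T (v FP.≟ k ⊎-dec v FP.≟ prev k) ([ inj₁ , (λ { refl → inj₂ (sym (prev-next v)) }) ]′ p)))
  where
  endpoints : ∀ k → incident {G = cycle _} v (cycleEdge k) ≡ does (v FP.≟ k) ∨ does (v FP.≟ prev k)
  endpoints zero    = refl
  endpoints (suc k) = ∨-comm (does (v FP.≟ F.inject₁ k)) (does (v FP.≟ suc k))

sum-cycleEdge : ∀ {n} (v : Fin (suc (suc n))) (g : Fin (suc (suc n)) → ℕ) →
  sum (λ k → [ incident {G = cycle (suc (suc n))} v (cycleEdge k) ]· g k) ≡ g v + g (next v)
sum-cycleEdge v g = trans (sum-cong-≗ λ k → cong ([_]· g k) (incident-cycleEdge v k)) (sum-pair g (next≢ v ∘ sym))

-- Lower bounds from proper colourings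

colouring-from-list : ∀ {a} {A : Set a} {n} {G : Graph n} (c : Fin n → A) (xs : List A) → (∀ u → c u ∈ xs) →
  (∀ u v → T (adj G u v) → c u ≢ c v) → ProperColouring G (length xs)
colouring-from-list c xs c∈ proper = (λ u → index (c∈ u)) , λ u v a eq → proper u v a
  (trans (lookup-index (c∈ u)) (trans (cong (lookup xs) eq) (sym (lookup-index (c∈ v)))))

vsum∈values : ∀ {n} {G : Graph n} (f : EdgeLabeling G) u → vsum f u ∈ deduplicate _≟_ (map (vsum f) (allFin n))
vsum∈values f u = ∈-deduplicate⁺ _≟_ (∈-map⁺ (vsum f) (∈-allFin u))

localAntimagic⇒colouring : ∀ {n} {G : Graph n} (f : EdgeLabeling G) → IsLocalAntimagic f → ProperColouring G (numValues f)
localAntimagic⇒colouring {G = G} f anti = colouring-from-list {G = G} (vsum f) _ (vsum∈values f) anti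

length-filter-¬ : ∀ {a p} {A : Set a} {P : Pred A p} (P? : Decidable P) (xs : List A) →
  length (filter P? xs) + length (filter (λ x → ¬? (P? x)) xs) ≡ length xs
length-filter-¬ P? []       = refl
length-filter-¬ P? (x ∷ xs) with P? x
... | yes _ = cong suc (length-filter-¬ P? xs)
... | no  _ = trans (+-suc _ _) (cong suc (length-filter-¬ P? xs))

-- Every vertex of `G` is adjacent to every vertex of `H`, so a colour used on `G` is absent from
-- `H`. The palette splits into the colours used on `G` and all the others.
join-colouring : ∀ {a b} (G : Graph a) (H : Graph b) {M} → ProperColouring (G ∨G H) M →
  ∃ λ x → ∃ λ y → ProperColouring G x × ProperColouring H y × x + y ≡ M
join-colouring {a} {b} G H {M} (c , proper) = _ , _ ,
  colouring-from-list {G = G} (λ u → c (u ↑ˡ b)) (filter used? (allFin M))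
    (λ u → ∈-filter⁺ used? (∈-allFin (c (u ↑ˡ b))) (u , refl))
    (λ u v e → proper (u ↑ˡ b) (v ↑ˡ b)
      (subst₂ (λ s t → T (joinAdj G H s t)) (sym (FP.splitAt-↑ˡ a u b)) (sym (FP.splitAt-↑ˡ a v b)) e)) ,
  colouring-from-list {G = H} (λ v → c (a ↑ʳ v)) (filter (λ x → ¬? (used? x)) (allFin M))
    (λ v → ∈-filter⁺ (λ x → ¬? (used? x)) (∈-allFin (c (a ↑ʳ v))) (λ { (u , eq) → proper (u ↑ˡ b) (a ↑ʳ v)
      (subst₂ (λ s t → T (joinAdj G H s t)) (sym (FP.splitAt-↑ˡ a u b)) (sym (FP.splitAt-↑ʳ a b v)) _) eq }))
    (λ u v e → proper (a ↑ʳ u) (a ↑ʳ v)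
      (subst₂ (λ s t → T (joinAdj G H s t)) (sym (FP.splitAt-↑ʳ a b u)) (sym (FP.splitAt-↑ʳ a b v)) e)) ,
  trans (length-filter-¬ used? (allFin M)) (length-tabulate id)
  where
  used? : ∀ x → Dec (∃ λ (u : Fin a) → c (u ↑ˡ b) ≡ x)
  used? x = FP.any? (λ u → c (u ↑ˡ b) FP.≟ x)

cycle-colours≥2 : ∀ {n M} → ProperColouring (cycle (suc (suc n))) M → 2 ≤ M
cycle-colours≥2 {M = zero}        (c , _) with () ← c zero
cycle-colours≥2 {n} {suc zero}    (c , proper) with c zero in eq₀ | c (next zero) in eq₁
... | zero | zero = contradiction (trans eq₀ (sym eq₁)) (proper zero (next zero) (adj-next {n} zero))
cycle-colours≥2 {M = suc (suc M)} _ = s≤s (s≤s z≤n)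

other-colour : Fin 2 → Fin 2
other-colour zero       = suc zero
other-colour (suc zero) = zero

alternate : ℕ → Fin 2 → Fin 2
alternate zero    x = x
alternate (suc n) x = other-colour (alternate n x)

alternate-even : ∀ k x → alternate (k * 2) x ≡ x
alternate-even zero    x = refl
alternate-even (suc k) x = trans (involutive _) (alternate-even k x)
  where
  involutive : ∀ x → other-colour (other-colour x) ≡ x
  involutive zero       = refl
  involutive (suc zero) = refl

-- Two colours must alternate along the path from 0 to the last vertex. That path has an even number
-- of edges, so its two ends, which are adjacent, get the same colour.
odd-cycle-not-2-colourable : ∀ {n} → 2 ∣ suc n → ¬ ProperColouring (cycle (suc (suc n))) 2
odd-cycle-not-2-colourable {n} (divides k eq) (c , proper) =
  proper zero (F.fromℕ (suc n)) (adj-prev {n} zero) (sym (begin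
    c (F.fromℕ (suc n))                             ≡⟨ along (F.fromℕ (suc n)) ⟩
    alternate (toℕ (F.fromℕ (suc n))) (c zero)      ≡⟨ cong (λ l → alternate l (c zero)) (trans (FP.toℕ-fromℕ (suc n)) eq) ⟩
    alternate (k * 2) (c zero)                      ≡⟨ alternate-even k (c zero) ⟩
    c zero                                          ∎))
  where
  open ≡-Reasoning
  opposite : ∀ (x y : Fin 2) → x ≢ y → y ≡ other-colour x
  opposite zero       zero       x≢y = contradiction refl x≢y
  opposite zero       (suc zero) x≢y = refl
  opposite (suc zero) zero       x≢y = refl
  opposite (suc zero) (suc zero) x≢y = contradiction refl x≢y
  along : ∀ v → c v ≡ alternate (toℕ v) (c zero)
  along = <-weakInduction (λ v → c v ≡ alternate (toℕ v) (c zero)) refl λ i ih → begin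
    c (suc i)                                                 ≡⟨ opposite _ _ (proper (F.inject₁ i) (suc i)
      (subst (λ j → T (adj (cycle (suc (suc n))) (F.inject₁ i) j)) (next-prev (suc i)) (adj-next (F.inject₁ i)))) ⟩
    other-colour (c (F.inject₁ i))                            ≡⟨ cong other-colour ih ⟩
    other-colour (alternate (toℕ (F.inject₁ i)) (c zero))     ≡⟨ cong (λ l → alternate (suc l) (c zero)) (FP.toℕ-inject₁ i) ⟩
    alternate (suc (toℕ i)) (c zero)                          ∎

odd-cycle-colours≥3 : ∀ {n M} → 2 ∣ suc n → ProperColouring (cycle (suc (suc n))) M → 3 ≤ M
odd-cycle-colours≥3 odd col with m≤n⇒m<n∨m≡n (cycle-colours≥2 col)
... | inj₁ 2<M  = 2<M
... | inj₂ refl = contradiction col (odd-cycle-not-2-colourable odd)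

iterJoin-colours : ∀ {p} (G : Graph p) m {c t} → (∀ M → ProperColouring G M → c ≤ M) →
  (∀ M → ProperColouring (cycle m) M → t ≤ M) → ∀ k M → ProperColouring (iterJoin G m k) M → c + t * k ≤ M
iterJoin-colours G m {c} {t} lowG lowC zero M col = subst (_≤ M) (sym (trans (cong (c +_) (*-zeroʳ t)) (+-identityʳ c))) (lowG M col)
iterJoin-colours G m {c} {t} lowG lowC (suc k) M col with join-colouring (iterJoin G m k) (cycle m) col
... | x , y , colG , colC , refl = begin
  c + t * suc k     ≡⟨ cong (c +_) (trans (*-suc t k) (+-comm t (t * k))) ⟩
  c + (t * k + t)   ≡⟨ +-assoc c (t * k) t ⟨
  c + t * k + t     ≤⟨ +-mono-≤ (iterJoin-colours G m lowG lowC k x colG) (lowC y colC) ⟩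
  x + y             ∎
  where open ≤-Reasoning

-- Layered labelings and the step of joining one more cycle

lookup-injective-unique : ∀ {a} {A : Set a} {xs : List A} → Unique xs → ∀ i j → lookup xs i ≡ lookup xs j → i ≡ j
lookup-injective-unique (x∉ ∷ u) zero    zero    eq = refl
lookup-injective-unique (x∉ ∷ u) (suc i) (suc j) eq = cong suc (lookup-injective-unique u i j eq)
lookup-injective-unique {xs = x ∷ xs} (x∉ ∷ u) zero    (suc j) eq = contradiction eq (All.lookup x∉ (∈-lookup {xs = xs} j))
lookup-injective-unique {xs = x ∷ xs} (x∉ ∷ u) (suc i) zero    eq = contradiction (sym eq) (All.lookup x∉ (∈-lookup {xs = xs} i))

-- Pick a vertex for each distinct vertex sum. Equal colours force equal sums, so different sums
-- have vertices of different colours, which injects the values into `Fin K`.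
numValues≤ : ∀ {n} {G : Graph n} (f : EdgeLabeling G) {K} (col : Fin n → Fin K) →
  (∀ u v → col u ≡ col v → vsum f u ≡ vsum f v) → numValues f ≤ K
numValues≤ {n} f {K} col col-vsum = FP.injective⇒≤ {f = col ∘ vertex} λ {i} {j} eq →
  lookup-injective-unique (deduplicate-! _≟_ (map (vsum f) (allFin n))) i j
    (trans (vertex-value i) (trans (col-vsum (vertex i) (vertex j) eq) (sym (vertex-value j))))
  where
  values = deduplicate _≟_ (map (vsum f) (allFin n))
  witness : ∀ i → ∃ λ u → u ∈ allFin n × lookup values i ≡ vsum f u
  witness i = ∈-map⁻ (vsum f) (∈-deduplicate⁻ _≟_ (map (vsum f) (allFin n)) (∈-lookup {xs = values} i))
  vertex : Fin (length values) → Fin n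
  vertex i = proj₁ (witness i)
  vertex-value : ∀ i → lookup values i ≡ vsum f (vertex i)
  vertex-value i = proj₂ (proj₂ (witness i))

-- A numbering of the new edges when C_m (m = suc m′) is joined to a graph with n vertices: inj₁ (u , v)
-- is the edge from the old vertex u to the cycle vertex v, inj₂ k is cycle edge k.
record Scheme (n m′ t : ℕ) (layer : Fin n → ℕ) : Set where
  field
    {size} : ℕ
    label↔ : ((Fin n × Fin (suc m′)) ⊎ Fin (suc m′)) ↔ Fin size

  value : (Fin n × Fin (suc m′)) ⊎ Fin (suc m′) → ℕ
  value x = toℕ (Inverse.to label↔ x)

  rowSum : Fin n → ℕ
  rowSum u = sum (λ v → value (inj₁ (u , v)))

  colSum : Fin (suc m′) → ℕ
  colSum v = sum (λ u → value (inj₁ (u , v))) + (value (inj₂ v) + value (inj₂ (next v)))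

  field
    rowSum-mono     : ∀ u u′ → layer u ≤ layer u′ → rowSum u ≤ rowSum u′
    rowSum≤colSum   : ∀ u v → rowSum u ≤ colSum v
    colour          : Fin (suc m′) → Fin t
    colour-colSum   : ∀ v w → colour v ≡ colour w → colSum v ≡ colSum w
    colSum-next     : ∀ v → colSum v ≢ colSum (next v)

-- The invariant of the iteration. `layer-vsum` separates adjacent vertices whose row sums may
-- differ; `colour-layer` ensures that vertices sharing a colour lie in one layer, hence gain equal
-- row sums and keep equal vertex sums.
record LayeredLabeling {n} (G : Graph n) (layer : Fin n → ℕ) (K : ℕ) : Set where
  field
    labeling      : EdgeLabeling G
    antimagic     : IsLocalAntimagic labeling
    layer-vsum    : ∀ u v → layer u < layer v → vsum labeling u < vsum labeling v
    colour        : Fin n → Fin K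
    colour-vsum   : ∀ u v → colour u ≡ colour v → vsum labeling u ≡ vsum labeling v
    colour-layer  : ∀ u v → colour u ≡ colour v → layer u ≡ layer v

joinLayer : ∀ {n} m → (Fin n → ℕ) → ℕ → Fin (n + m) → ℕ
joinLayer {n} m layer top x = [ layer , (λ _ → top) ]′ (splitAt n x)

-- An old vertex and a new one have equal degrees, and the new labels exceed the old ones; after
-- subtracting q f + 1 from the new labels, V-old<new therefore only needs rowSum ≤ colSum.
extend : ∀ {n l t d K} {G : Graph n} {layer : Fin n → ℕ} {top} → LayeredLabeling G layer K → Scheme n (2 + l) t layer →
  (∀ u → layer u < top) → IsRegular G (suc d) → suc d + (3 + l) ≡ n + 2 →
  LayeredLabeling (G ∨G cycle (3 + l)) (joinLayer (3 + l) layer top) (K + t)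
extend {n} {l} {t} {d} {K} {G} {layer} {top} L S layer<top regular order = record
  { labeling     = f′
  ; antimagic    = λ x y e eq → V-antimagic (splitAt n x) (splitAt n y) e (trans (sym (vsum-V x)) (trans eq (vsum-V y)))
  ; layer-vsum   = λ x y lt → subst₂ _<_ (sym (vsum-V x)) (sym (vsum-V y)) (V-layer (splitAt n x) (splitAt n y) lt)
  ; colour       = colour′ ∘ splitAt n
  ; colour-vsum  = λ x y eq → trans (vsum-V x) (trans (V-colour (splitAt n x) (splitAt n y) eq) (sym (vsum-V y)))
  ; colour-layer = λ x y → colour-layer′ (splitAt n x) (splitAt n y)
  }
  where
  open LayeredLabeling L renaming (labeling to f)
  open Scheme S renaming (colour to colourS)
  m = 3 + l
  Q = suc (q f)
  f′ = joinLabeling G (cycle m) f (cycleEdges↔ l) label↔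

  -- Every new label is `Q` plus its `value`. An old vertex meets m new edges, a cycle vertex meets
  -- n + 2.
  V : Fin n ⊎ Fin m → ℕ
  V (inj₁ u) = vsum f u + (m * Q + rowSum u)
  V (inj₂ v) = n * Q + (Q + Q) + colSum v

  shift : ∀ {k} (g : Fin k → ℕ) → sum (λ i → suc (q f + g i)) ≡ k * Q + sum g
  shift {k} g = trans (∑-distrib-+ (λ _ → Q) g) (cong (_+ sum g) (sum-const k Q))

  vsum-V : ∀ x → vsum f′ x ≡ V (splitAt n x)
  vsum-V x with splitAt n x in eq
  ... | inj₁ u = trans (cong (vsum f′) (sym (FP.splitAt⁻¹-↑ˡ eq)))
    (trans (vsum-joinˡ G (cycle m) f (cycleEdges↔ l) label↔ u)
           (cong (vsum f u +_) (shift (λ v → value (inj₁ (u , v))))))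
  ... | inj₂ v = begin
    vsum f′ x
      ≡⟨ cong (vsum f′) (sym (FP.splitAt⁻¹-↑ʳ eq)) ⟩
    vsum f′ (n ↑ʳ v)
      ≡⟨ vsum-joinʳ G (cycle m) f (cycleEdges↔ l) label↔ v ⟩
    sum (λ u → suc (q f + value (inj₁ (u , v)))) + sum (λ k → [ incident {G = cycle m} v (cycleEdge k) ]· suc (q f + value (inj₂ k)))
      ≡⟨ cong₂ _+_ (shift (λ u → value (inj₁ (u , v)))) (sum-cycleEdge v (λ k → suc (q f + value (inj₂ k)))) ⟩
    n * Q + sum (λ u → value (inj₁ (u , v))) + (Q + value (inj₂ v) + (Q + value (inj₂ (next v))))
      ≡⟨ rearrange (n * Q) _ Q (value (inj₂ v)) (value (inj₂ (next v))) ⟩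
    V (inj₂ v) ∎
    where
    open ≡-Reasoning
    rearrange : ∀ a s k x y → a + s + (k + x + (k + y)) ≡ a + (k + k) + (s + (x + y))
    rearrange = solve-∀

  rowSum-cong : ∀ u u′ → layer u ≡ layer u′ → rowSum u ≡ rowSum u′
  rowSum-cong u u′ eq = ≤-antisym (rowSum-mono u u′ (≤-reflexive eq)) (rowSum-mono u′ u (≤-reflexive (sym eq)))

  V-old<new : ∀ u v → V (inj₁ u) < V (inj₂ v)
  V-old<new u v = begin-strict
    vsum f u + (m * Q + rowSum u)          ≤⟨ +-monoˡ-≤ _ (vsum≤degree*q f u) ⟩
    degree G u * q f + (m * Q + rowSum u)  ≡⟨ cong (λ x → x * q f + (m * Q + rowSum u)) (regular u) ⟩
    -- Strict because the degree is positive and `q f` is smaller than `Q`.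
    suc d * q f + (m * Q + rowSum u)       <⟨ +-mono-<-≤ (*-monoʳ-< (suc d) (n<1+n (q f))) (+-monoʳ-≤ (m * Q) (rowSum≤colSum u v)) ⟩
    suc d * Q + (m * Q + colSum v)         ≡⟨ +-assoc (suc d * Q) (m * Q) (colSum v) ⟨
    suc d * Q + m * Q + colSum v           ≡⟨ cong (_+ colSum v) (*-distribʳ-+ Q (suc d) m) ⟨
    (suc d + m) * Q + colSum v             ≡⟨ cong (λ x → x * Q + colSum v) order ⟩
    (n + 2) * Q + colSum v                 ≡⟨ cong (_+ colSum v) (trans (*-distribʳ-+ Q n 2) (cong (n * Q +_) (cong (Q +_) (+-identityʳ Q)))) ⟩
    n * Q + (Q + Q) + colSum v             ∎
    where open ≤-Reasoning

  V-layer : ∀ s t → [ layer , (λ _ → top) ]′ s < [ layer , (λ _ → top) ]′ t → V s < V t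
  V-layer (inj₁ u) (inj₁ u′) lt = +-mono-<-≤ (layer-vsum u u′ lt) (+-monoʳ-≤ (m * Q) (rowSum-mono u u′ (<⇒≤ lt)))
  V-layer (inj₁ u) (inj₂ v)  lt = V-old<new u v
  V-layer (inj₂ v) (inj₁ u)  lt = contradiction lt (<-asym (layer<top u))
  V-layer (inj₂ v) (inj₂ v′) lt = contradiction lt (<-irrefl refl)

  V-antimagic : ∀ s t → T (joinAdj G (cycle m) s t) → V s ≢ V t
  V-antimagic (inj₁ u) (inj₁ u′) e eq with <-cmp (layer u) (layer u′)
  ... | tri< lt _ _ = <⇒≢ (V-layer (inj₁ u) (inj₁ u′) lt) eq
  ... | tri> _ _ gt = <⇒≢ (V-layer (inj₁ u′) (inj₁ u) gt) (sym eq)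
  -- Within a layer both ends gain the same amount, so the old labeling decides.
  ... | tri≈ _ le _ = antimagic u u′ e (+-cancelʳ-≡ (m * Q + rowSum u) _ _
    (trans eq (cong (λ x → vsum f u′ + (m * Q + x)) (sym (rowSum-cong u u′ le)))))
  V-antimagic (inj₁ u) (inj₂ v)  e eq = <⇒≢ (V-old<new u v) eq
  V-antimagic (inj₂ v) (inj₁ u)  e eq = <⇒≢ (V-old<new u v) (sym eq)
  V-antimagic (inj₂ v) (inj₂ w)  e eq with adj-cycle⁻ {i = v} {w} e
  ... | inj₁ refl = colSum-next v (+-cancelˡ-≡ (n * Q + (Q + Q)) _ _ eq)
  ... | inj₂ refl = colSum-next w (sym (+-cancelˡ-≡ (n * Q + (Q + Q)) _ _ eq))

  colour′ : Fin n ⊎ Fin m → Fin (K + t)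
  colour′ (inj₁ u) = colour u ↑ˡ t
  colour′ (inj₂ v) = K ↑ʳ colourS v

  V-colour : ∀ s t → colour′ s ≡ colour′ t → V s ≡ V t
  V-colour (inj₁ u) (inj₁ u′) eq = cong₂ (λ x y → x + (m * Q + y)) (colour-vsum u u′ eq′) (rowSum-cong u u′ (colour-layer u u′ eq′))
    where eq′ = FP.↑ˡ-injective t _ _ eq
  V-colour (inj₁ u) (inj₂ v)  eq = contradiction eq (↑ˡ≢↑ʳ (colour u) (colourS v))
  V-colour (inj₂ v) (inj₁ u)  eq = contradiction (sym eq) (↑ˡ≢↑ʳ (colour u) (colourS v))
  V-colour (inj₂ v) (inj₂ w)  eq = cong (n * Q + (Q + Q) +_) (colour-colSum v w (FP.↑ʳ-injective K _ _ eq))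

  colour-layer′ : ∀ s t → colour′ s ≡ colour′ t → [ layer , (λ _ → top) ]′ s ≡ [ layer , (λ _ → top) ]′ t
  colour-layer′ (inj₁ u) (inj₁ u′) eq = colour-layer u u′ (FP.↑ˡ-injective t _ _ eq)
  colour-layer′ (inj₁ u) (inj₂ v)  eq = contradiction eq (↑ˡ≢↑ʳ (colour u) (colourS v))
  colour-layer′ (inj₂ v) (inj₁ u)  eq = contradiction (sym eq) (↑ˡ≢↑ʳ (colour u) (colourS v))
  colour-layer′ (inj₂ v) (inj₂ w)  eq = refl

-- Latin arrays of blocks and residues

cycleShift : ∀ n → Permutation′ (suc n)
cycleShift n = Perm.permutation next prev next-prev prev-next

rotate : ∀ {n} → ℕ → Permutation′ (suc n)
rotate zero        = Perm.id
rotate {n} (suc k) = rotate k ∘ₚ cycleShift n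

toℕ-rotate : ∀ {n} k (x : Fin (suc n)) → toℕ (rotate k ⟨$⟩ʳ x) ≡ (toℕ x + k) % suc n
toℕ-rotate {n} zero x = sym (trans (cong (_% suc n) (+-identityʳ (toℕ x))) (m<n⇒m%n≡m (FP.toℕ<n x)))
toℕ-rotate {n} (suc k) x = begin
  toℕ (next (rotate k ⟨$⟩ʳ x))              ≡⟨ toℕ-next (rotate k ⟨$⟩ʳ x) ⟩
  (toℕ (rotate k ⟨$⟩ʳ x) + 1) % suc n       ≡⟨ cong (λ y → (y + 1) % suc n) (toℕ-rotate k x) ⟩
  ((toℕ x + k) % suc n + 1) % suc n         ≡⟨ %-+ˡ (toℕ x + k) 1 ⟩
  (toℕ x + k + 1) % suc n                   ≡⟨ cong (_% suc n) (trans (+-comm _ 1) (sym (+-suc (toℕ x) k))) ⟩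
  (toℕ x + suc k) % suc n                   ∎
  where
  open ≡-Reasoning
  %-+ˡ : ∀ a b → (a % suc n + b) % suc n ≡ (a + b) % suc n
  %-+ˡ a b = trans (%-distribˡ-+ (a % suc n) b (suc n))
    (trans (cong (λ y → (y + b % suc n) % suc n) (m%n%n≡m%n a (suc n))) (sym (%-distribˡ-+ a b (suc n))))

opposite+ : ∀ {n} (i : Fin n) → toℕ (F.opposite i) + suc (toℕ i) ≡ n
opposite+ i = trans (cong (_+ suc (toℕ i)) (FP.opposite-prop i)) (m∸n+n≡m (FP.toℕ<n i))

sum-opposite : ∀ n → sum {n} (toℕ ∘ F.opposite) ≡ sum {n} toℕ
sum-opposite n = sym (sum-permute {n} toℕ Perm.reverse)

-- Gauss's pairing of i with n - 1 - i; adding n avoids both subtraction and division.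
sum-toℕ : ∀ n → sum {n} toℕ + sum {n} toℕ + n ≡ n * n
sum-toℕ n = begin
  sum {n} toℕ + sum {n} toℕ + n                      ≡⟨ cong (λ x → x + sum {n} toℕ + n) (sum-opposite n) ⟨
  sum {n} (toℕ ∘ F.opposite) + sum {n} toℕ + n       ≡⟨ cong (_+ n) (∑-distrib-+ {n} (toℕ ∘ F.opposite) toℕ) ⟨
  sum {n} (λ i → toℕ (F.opposite i) + toℕ i) + n     ≡⟨ cong (sum {n} (λ i → toℕ (F.opposite i) + toℕ i) +_) (trans (sum-const n 1) (*-identityʳ n)) ⟨
  sum {n} (λ i → toℕ (F.opposite i) + toℕ i) + sum {n} (λ _ → 1) ≡⟨ ∑-distrib-+ {n} (λ i → toℕ (F.opposite i) + toℕ i) (λ _ → 1) ⟨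
  sum {n} (λ i → toℕ (F.opposite i) + toℕ i + 1)     ≡⟨ sum-cong-≗ {n} (λ i → trans (+-assoc (toℕ (F.opposite i)) (toℕ i) 1)
                                                          (trans (cong (toℕ (F.opposite i) +_) (+-comm (toℕ i) 1)) (opposite+ i))) ⟩
  sum {n} (λ _ → n)                                  ≡⟨ sum-const n n ⟩
  n * n                                              ∎
  where open ≡-Reasoning

-- The entry in row r and column v is n a + t (or (n + 1) a + t + 1 in WithEdges, where the residue 0
-- is kept for the cycle edge e⁻¹ a) with block a = block r v and residue t = residue r v.
module Latin {n m} (blk : Fin n → Permutation′ m) (β : Fin m → Permutation′ n) where

  block : Fin n → Fin m → Fin m
  block r v = blk r ⟨$⟩ʳ v

  residue : Fin n → Fin m → Fin n
  residue r v = β (block r v) ⟨$⟩ʳ r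

  -- A block and a residue determine the row, since `β a` permutes the rows; the row and the block
  -- then determine the column, since `blk r` permutes the blocks.
  latin↔ : (Fin n × Fin m) ↔ (Fin m × Fin n)
  latin↔ = mk↔ₛ′ (λ { (r , v) → block r v , residue r v })
                 (λ { (a , t) → β a ⟨$⟩ˡ t , blk (β a ⟨$⟩ˡ t) ⟨$⟩ˡ a })
                 (λ { (a , t) → to∘from a t })
                 (λ { (r , v) → from∘to r v })
    where
    to∘from : ∀ a t → let r = β a ⟨$⟩ˡ t ; v = blk r ⟨$⟩ˡ a in (block r v , residue r v) ≡ (a , t)
    to∘from a t rewrite Perm.inverseʳ (blk (β a ⟨$⟩ˡ t)) {a} | Perm.inverseʳ (β a) {t} = refl
    from∘to : ∀ r v → let a = block r v ; t = residue r v in (β a ⟨$⟩ˡ t , blk (β a ⟨$⟩ˡ t) ⟨$⟩ˡ a) ≡ (r , v)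
    from∘to r v rewrite Perm.inverseˡ (β (block r v)) {r} | Perm.inverseˡ (blk r) {v} = refl

  square↔ : (Fin n × Fin m) ↔ Fin (m * n)
  square↔ = ↔-sym FP.*↔× ↔-∘ latin↔

  toℕ-square : ∀ r v → toℕ (Inverse.to square↔ (r , v)) ≡ n * toℕ (block r v) + toℕ (residue r v)
  toℕ-square r v = FP.toℕ-combine (block r v) (residue r v)

  sum-row : ∀ r (g : Fin m → ℕ) → sum (λ v → g (block r v)) ≡ sum g
  sum-row r g = sym (sum-permute g (blk r))

  module WithEdges (e : Permutation′ m) where

    private
      attach : ((Fin m × Fin n) ⊎ Fin m) ↔ (Fin m × Fin (suc n))
      attach = mk↔ₛ′ (λ { (inj₁ (a , t)) → a , suc t ; (inj₂ a) → a , zero })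
                     (λ { (a , zero) → inj₂ a ; (a , suc t) → inj₁ (a , t) })
                     (λ { (a , zero) → refl ; (a , suc t) → refl })
                     (λ { (inj₁ _) → refl ; (inj₂ _) → refl })

    label↔ : ((Fin n × Fin m) ⊎ Fin m) ↔ Fin (m * suc n)
    label↔ = (↔-sym FP.*↔× ↔-∘ attach) ↔-∘ (latin↔ ⊎-↔ e)

    value-cross : ∀ r v → toℕ (Inverse.to label↔ (inj₁ (r , v))) ≡ suc n * toℕ (block r v) + suc (toℕ (residue r v))
    value-cross r v = FP.toℕ-combine (block r v) (suc (residue r v))

    value-edge : ∀ k → toℕ (Inverse.to label↔ (inj₂ k)) ≡ suc n * toℕ (e ⟨$⟩ʳ k)
    value-edge k = trans (FP.toℕ-combine (e ⟨$⟩ʳ k) (zero {n})) (+-identityʳ _)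

-- A row meets every block once, so a constant residue sum ρ makes the row sums equal. A constant
-- block total `B` at the cycle vertices leaves only `D` to distinguish columns. The final
-- inequality compares a row with the block part of a column, which is already large enough.
latinScheme : ∀ {n m′ t} (layer : Fin n → ℕ) (blk : Fin n → Permutation′ (suc m′)) (β : Fin (suc m′) → Permutation′ n)
  (e : Permutation′ (suc m′)) {ρ B} (colour : Fin (suc m′) → Fin t) (D : Fin t → ℕ) →
  (∀ r → sum (λ a → toℕ (β a ⟨$⟩ʳ r)) ≡ ρ) →
  (∀ v → sum (λ r → toℕ (blk r ⟨$⟩ʳ v)) + (toℕ (e ⟨$⟩ʳ v) + toℕ (e ⟨$⟩ʳ next v)) ≡ B) →
  (∀ v → sum (λ r → toℕ (β (blk r ⟨$⟩ʳ v) ⟨$⟩ʳ r)) ≡ D (colour v)) →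
  (∀ v → D (colour v) ≢ D (colour (next v))) →
  suc n * sum {suc m′} toℕ + (suc m′ + ρ) ≤ suc n * B →
  Scheme n m′ t layer
latinScheme {n} {m′} layer blk β e {ρ} {B} colour D rows blocks cols distinct bound = record
  { label↔        = label↔
  ; rowSum-mono   = λ u u′ _ → ≤-reflexive (trans (row u) (sym (row u′)))
  ; rowSum≤colSum = λ u v → begin
      sum (λ v → toℕ (Inverse.to label↔ (inj₁ (u , v))))       ≡⟨ row u ⟩
      suc n * sum {suc m′} toℕ + (suc m′ + ρ)                  ≤⟨ bound ⟩
      suc n * B                                                ≤⟨ m≤m+n _ _ ⟩
      suc n * B + (n + D (colour v))                           ≡⟨ col v ⟨
      _                                                        ∎
  ; colour        = colour
  ; colour-colSum = λ v w eq → trans (col v) (trans (cong (λ c → suc n * B + (n + D c)) eq) (sym (col w)))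
  ; colSum-next   = λ v eq → distinct v (+-cancelˡ-≡ n _ _ (+-cancelˡ-≡ (suc n * B) _ _
      (trans (sym (col v)) (trans eq (col (next v))))))
  }
  where
  open ≤-Reasoning
  open Latin blk β
  open WithEdges e
  sum-cross : ∀ {k} (a t : Fin k → ℕ) → sum (λ i → suc n * a i + suc (t i)) ≡ suc n * sum a + (k + sum t)
  sum-cross {k} a t = begin-equality
    sum (λ i → suc n * a i + suc (t i))        ≡⟨ ∑-distrib-+ (λ i → suc n * a i) (λ i → suc (t i)) ⟩
    sum (λ i → suc n * a i) + sum (λ i → suc (t i)) ≡⟨ cong₂ _+_ (sum-*ˡ (suc n) a) (∑-distrib-+ (λ _ → 1) t) ⟩
    suc n * sum a + (sum {k} (λ _ → 1) + sum t) ≡⟨ cong (λ x → suc n * sum a + (x + sum t)) (trans (sum-const k 1) (*-identityʳ k)) ⟩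
    suc n * sum a + (k + sum t)                ∎
  row : ∀ u → sum (λ v → toℕ (Inverse.to label↔ (inj₁ (u , v)))) ≡ suc n * sum {suc m′} toℕ + (suc m′ + ρ)
  row u = begin-equality
    sum (λ v → toℕ (Inverse.to label↔ (inj₁ (u , v))))    ≡⟨ sum-cong-≗ (value-cross u) ⟩
    sum (λ v → suc n * toℕ (block u v) + suc (toℕ (residue u v)))
      ≡⟨ sum-row u (λ a → suc n * toℕ a + suc (toℕ (β a ⟨$⟩ʳ u))) ⟩
    sum (λ a → suc n * toℕ a + suc (toℕ (β a ⟨$⟩ʳ u)))    ≡⟨ sum-cross toℕ (λ a → toℕ (β a ⟨$⟩ʳ u)) ⟩
    suc n * sum {suc m′} toℕ + (suc m′ + sum (λ a → toℕ (β a ⟨$⟩ʳ u))) ≡⟨ cong (λ x → suc n * sum {suc m′} toℕ + (suc m′ + x)) (rows u) ⟩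
    _ ∎
  regroup : ∀ c s x y z → c * s + z + (c * x + c * y) ≡ c * (s + (x + y)) + z
  regroup = solve-∀
  col : ∀ v → sum (λ u → toℕ (Inverse.to label↔ (inj₁ (u , v)))) +
      (toℕ (Inverse.to label↔ (inj₂ v)) + toℕ (Inverse.to label↔ (inj₂ (next v)))) ≡ suc n * B + (n + D (colour v))
  col v = begin-equality
    sum (λ u → toℕ (Inverse.to label↔ (inj₁ (u , v)))) + (toℕ (Inverse.to label↔ (inj₂ v)) + toℕ (Inverse.to label↔ (inj₂ (next v))))
      ≡⟨ cong₂ _+_ (trans (sum-cong-≗ (λ u → value-cross u v)) (sum-cross (λ u → toℕ (block u v)) (λ u → toℕ (residue u v))))
                   (cong₂ _+_ (value-edge v) (value-edge (next v))) ⟩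
    suc n * sum (λ u → toℕ (block u v)) + (n + sum (λ u → toℕ (residue u v))) + (suc n * toℕ (e ⟨$⟩ʳ v) + suc n * toℕ (e ⟨$⟩ʳ next v))
      ≡⟨ regroup (suc n) (sum (λ u → toℕ (block u v))) (toℕ (e ⟨$⟩ʳ v)) (toℕ (e ⟨$⟩ʳ next v)) (n + sum (λ u → toℕ (residue u v))) ⟩
    suc n * (sum (λ u → toℕ (block u v)) + (toℕ (e ⟨$⟩ʳ v) + toℕ (e ⟨$⟩ʳ next v))) + (n + sum (λ u → toℕ (residue u v)))
      ≡⟨ cong₂ (λ x y → suc n * x + (n + y)) (blocks v) (cols v) ⟩
    suc n * B + (n + D (colour v)) ∎

-- The scheme for m even

isEven : ℕ → Bool
isEven zero          = true
isEven (suc zero)    = false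
isEven (suc (suc n)) = isEven n

isEven-suc : ∀ n → isEven (suc n) ≡ not (isEven n)
isEven-suc zero          = refl
isEven-suc (suc zero)    = refl
isEven-suc (suc (suc n)) = isEven-suc n

isEven-*2 : ∀ h → isEven (h * 2) ≡ true
isEven-*2 zero    = refl
isEven-*2 (suc h) = isEven-*2 h

isEven-complement : ∀ a b → isEven (a + suc b) ≡ true → isEven a ≡ not (isEven b)
isEven-complement zero          b eq = trans (sym eq) (isEven-suc b)
isEven-complement (suc zero)    b eq = cong not (sym eq)
isEven-complement (suc (suc a)) b eq = isEven-complement a b eq

sum-alternating : ∀ {m} h → m ≡ h * 2 → (g : Bool → ℕ) → sum {m} (λ a → g (isEven (toℕ a))) ≡ h * (g true + g false)
sum-alternating zero    refl g = refl
sum-alternating (suc h) refl g = trans (sym (+-assoc (g true) (g false) _))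
  (cong (g true + g false +_) (sum-alternating h refl g))

-- Cycle edge k has block k, and vertex v lies on the edges v and v + 1.  The blocks in column v are
-- m′ - v (first half of the rows), m′ - (v + 1 mod m) (one row) and v (the others), so the blocks at
-- every cycle vertex have the same total.  Even blocks list the residues upwards and odd ones
-- downwards, which makes the residues at v depend on the parity of v only.
evenScheme : ∀ ν m′ h (layer : Fin (suc ν + suc ν) → ℕ) → suc m′ ≡ h * 2 → h ≤ suc ν →
  Scheme (suc ν + suc ν) m′ 2 layer
evenScheme ν m′ h layer m≡2h h≤ν = latinScheme layer blk (λ a → orient (isEven (toℕ a))) Perm.id colour D
  rows blocks (λ v → trans (cols v) (D-colour v)) distinct bound
  where
  n = suc ν + suc ν
  m = suc m′

  orient : ∀ {k} → Bool → Permutation′ k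
  orient true  = Perm.id
  orient false = Perm.reverse

  -- The cycle edges at `v` contribute `v` and `next v`. The exceptional row cancels `next v`, and
  -- the edge `v` replaces the one row thereby missing from the second half, so everything pairs off
  -- to m′.
  pick : Fin (suc ν) ⊎ Fin (suc ν) → Permutation′ m
  pick (inj₁ _)       = Perm.reverse
  pick (inj₂ zero)    = cycleShift m′ ∘ₚ Perm.reverse
  pick (inj₂ (suc _)) = Perm.id

  blk : Fin n → Permutation′ m
  blk r = pick (splitAt (suc ν) r)

  blk-low : ∀ i → blk (i ↑ˡ suc ν) ≡ Perm.reverse
  blk-low i = cong pick (FP.splitAt-↑ˡ (suc ν) i (suc ν))

  blk-high : ∀ j → blk (suc ν ↑ʳ j) ≡ pick (inj₂ j)
  blk-high j = cong pick (FP.splitAt-↑ʳ (suc ν) (suc ν) j)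

  even-opposite : ∀ (v : Fin m) → isEven (toℕ (F.opposite v)) ≡ not (isEven (toℕ v))
  even-opposite v = isEven-complement (toℕ (F.opposite v)) (toℕ v)
    (trans (cong isEven (trans (opposite+ v) m≡2h)) (isEven-*2 h))

  -- Parity also changes on the way from the last vertex to 0, because m is even.
  even-next : ∀ (v : Fin m) → isEven (toℕ (next v)) ≡ not (isEven (toℕ v))
  even-next v with view v
  ... | ‵fromℕ = begin
    isEven (toℕ (next (F.fromℕ m′)))    ≡⟨ cong (isEven ∘ toℕ) (next-prev (zero {m′})) ⟩
    true                                ≡⟨ isEven-*2 h ⟨
    isEven (h * 2)                      ≡⟨ cong isEven m≡2h ⟨
    isEven m                            ≡⟨ isEven-suc m′ ⟩
    not (isEven m′)                     ≡⟨ cong (not ∘ isEven) (FP.toℕ-fromℕ m′) ⟨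
    not (isEven (toℕ (F.fromℕ m′)))     ∎
    where open ≡-Reasoning
  ... | ‵inject₁ j = begin
    isEven (toℕ (next (F.inject₁ j)))   ≡⟨ cong (isEven ∘ toℕ) (next-prev (suc j)) ⟩
    isEven (suc (toℕ j))                ≡⟨ isEven-suc (toℕ j) ⟩
    not (isEven (toℕ j))                ≡⟨ cong (not ∘ isEven) (FP.toℕ-inject₁ j) ⟨
    not (isEven (toℕ (F.inject₁ j)))    ∎
    where open ≡-Reasoning

  -- The residue total of a column of parity `b`. Mirroring changes parity because m is even, so the
  -- first half of the rows has blocks of the other parity. The exceptional row is mirrored and
  -- shifted, and so has parity `b` like the rest of the second half.
  half : Bool → ℕ
  half b = sum {suc ν} (λ i → toℕ (orient (not b) ⟨$⟩ʳ (i ↑ˡ suc ν))) + sum {suc ν} (λ j → toℕ (orient b ⟨$⟩ʳ (suc ν ↑ʳ j)))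

  opposite-low : ∀ (i : Fin (suc ν)) → toℕ (i ↑ˡ suc ν) < toℕ (F.opposite (i ↑ˡ suc ν))
  opposite-low i = +-cancelʳ-< (suc (toℕ (i ↑ˡ suc ν))) _ _ (begin-strict
    toℕ (i ↑ˡ suc ν) + suc (toℕ (i ↑ˡ suc ν))  ≡⟨ cong (λ x → x + suc x) (FP.toℕ-↑ˡ i (suc ν)) ⟩
    toℕ i + suc (toℕ i)                        <⟨ +-mono-<-≤ (FP.toℕ<n i) (FP.toℕ<n i) ⟩
    suc ν + suc ν                              ≡⟨ opposite+ (i ↑ˡ suc ν) ⟨
    _                                          ∎)
    where open ≤-Reasoning

  opposite-high : ∀ (j : Fin (suc ν)) → toℕ (F.opposite (suc ν ↑ʳ j)) ≤ toℕ (suc ν ↑ʳ j)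
  opposite-high j = +-cancelʳ-≤ (suc (toℕ (suc ν ↑ʳ j))) _ _ (begin
    toℕ (F.opposite (suc ν ↑ʳ j)) + suc (toℕ (suc ν ↑ʳ j))  ≡⟨ opposite+ (suc ν ↑ʳ j) ⟩
    suc ν + suc ν                                            ≤⟨ +-mono-≤ (m≤m+n (suc ν) (toℕ j)) (≤-trans (m≤m+n (suc ν) (toℕ j)) (n≤1+n _)) ⟩
    (suc ν + toℕ j) + suc (suc ν + toℕ j)                    ≡⟨ cong (λ x → x + suc x) (FP.toℕ-↑ʳ (suc ν) j) ⟨
    toℕ (suc ν ↑ʳ j) + suc (toℕ (suc ν ↑ʳ j))                ∎)
    where open ≤-Reasoning

  -- In every row r an even column takes the larger of r and n - 1 - r, an odd column the smaller.
  half-< : half false < half true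
  half-< = +-mono-<-≤ (sum-mono-< {suc ν} {λ i → toℕ (i ↑ˡ suc ν)} {λ i → toℕ (F.opposite (i ↑ˡ suc ν))} (<⇒≤ ∘ opposite-low) zero (opposite-low zero)) (sum-mono-≤ {suc ν} {λ j → toℕ (F.opposite (suc ν ↑ʳ j))} {λ j → toℕ (suc ν ↑ʳ j)} opposite-high)

  colour : Fin m → Fin 2
  colour v = if isEven (toℕ v) then zero else suc zero

  D : Fin 2 → ℕ
  D zero    = half true
  D (suc _) = half false

  D-colour : ∀ v → half (isEven (toℕ v)) ≡ D (colour v)
  D-colour v with isEven (toℕ v)
  ... | true  = refl
  ... | false = refl

  distinct : ∀ v → D (colour v) ≢ D (colour (next v))
  distinct v eq = half-≢ (isEven (toℕ v)) (trans (D-colour v) (trans eq (trans (sym (D-colour (next v))) (cong half (even-next v)))))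
    where
    half-≢ : ∀ b → half b ≢ half (not b)
    half-≢ true  eq = <⇒≢ half-< (sym eq)
    half-≢ false eq = <⇒≢ half-< eq

  cols : ∀ v → sum (λ r → toℕ (orient (isEven (toℕ (blk r ⟨$⟩ʳ v))) ⟨$⟩ʳ r)) ≡ half (isEven (toℕ v))
  cols v = trans (sum-++ (suc ν) (λ r → toℕ (orient (isEven (toℕ (blk r ⟨$⟩ʳ v))) ⟨$⟩ʳ r))) (cong₂ _+_
    (sum-cong-≗ {suc ν} λ i → cong (λ b → toℕ (orient b ⟨$⟩ʳ (i ↑ˡ suc ν)))
      (trans (cong (λ π → isEven (toℕ (π ⟨$⟩ʳ v))) (blk-low i)) (even-opposite v)))
    (sum-cong-≗ {suc ν} λ j → cong (λ b → toℕ (orient b ⟨$⟩ʳ (suc ν ↑ʳ j)))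
      (trans (cong (λ π → isEven (toℕ (π ⟨$⟩ʳ v))) (blk-high j)) (high j))))
    where
    high : ∀ j → isEven (toℕ (pick (inj₂ j) ⟨$⟩ʳ v)) ≡ isEven (toℕ v)
    high zero    = trans (even-opposite (next v)) (trans (cong not (even-next v)) (not-involutive _))
    high (suc _) = refl

  rows : ∀ r → sum {m} (λ a → toℕ (orient (isEven (toℕ a)) ⟨$⟩ʳ r)) ≡ h * (ν + suc ν)
  rows r = trans (sum-alternating h m≡2h (λ b → toℕ (orient b ⟨$⟩ʳ r)))
    (cong (h *_) (suc-injective (trans (+-comm (suc (toℕ r)) _) (opposite+ r))))

  opposite′ : ∀ (v : Fin m) → toℕ (F.opposite v) + toℕ v ≡ m′
  opposite′ v = suc-injective (trans (sym (+-suc _ _)) (opposite+ v))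

  blocks : ∀ v → sum (λ r → toℕ (blk r ⟨$⟩ʳ v)) + (toℕ v + toℕ (next v)) ≡ (2 + ν) * m′
  blocks v = begin
    sum (λ r → toℕ (blk r ⟨$⟩ʳ v)) + (x + y)
      ≡⟨ cong (_+ (x + y)) (trans (sum-++ (suc ν) (λ r → toℕ (blk r ⟨$⟩ʳ v))) (cong₂ _+_
          (trans (sum-cong-≗ {suc ν} λ i → cong (λ π → toℕ (π ⟨$⟩ʳ v)) (blk-low i)) (sum-const (suc ν) x̄))
          (trans (sum-cong-≗ {suc ν} λ j → cong (λ π → toℕ (π ⟨$⟩ʳ v)) (blk-high j)) (cong (ȳ +_) (sum-const ν x))))) ⟩
    suc ν * x̄ + (ȳ + ν * x) + (x + y)
      ≡⟨ regroup ν x x̄ y ȳ ⟩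
    suc ν * (x̄ + x) + (ȳ + y)
      ≡⟨ cong₂ (λ a b → suc ν * a + b) (opposite′ v) (opposite′ (next v)) ⟩
    suc ν * m′ + m′
      ≡⟨ +-comm (suc ν * m′) m′ ⟩
    (2 + ν) * m′ ∎
    where
    open ≡-Reasoning
    x = toℕ v
    y = toℕ (next v)
    x̄ = toℕ (F.opposite v)
    ȳ = toℕ (F.opposite (next v))
    regroup : ∀ ν x x̄ y ȳ → suc ν * x̄ + (ȳ + ν * x) + (x + y) ≡ suc ν * (x̄ + x) + (ȳ + y)
    regroup = solve-∀

  triangle : sum {m} toℕ ≡ h * m′
  triangle = *-cancelʳ-≡ _ _ 2 (+-cancelʳ-≡ m _ _ (begin
    sum {m} toℕ * 2 + m              ≡⟨ cong (_+ m) (trans (*-comm (sum {m} toℕ) 2) (cong (sum {m} toℕ +_) (+-identityʳ _))) ⟩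
    sum {m} toℕ + sum {m} toℕ + m    ≡⟨ sum-toℕ m ⟩
    m * m                            ≡⟨ +-comm m (m′ * m) ⟩
    m′ * m + m                       ≡⟨ cong (λ x → m′ * x + m) m≡2h ⟩
    m′ * (h * 2) + m                 ≡⟨ cong (_+ m) (trans (sym (*-assoc m′ h 2)) (cong (_* 2) (*-comm m′ h))) ⟩
    h * m′ * 2 + m                   ∎))
    where open ≡-Reasoning

  h≤m′ : h ≤ m′
  h≤m′ = aux h m≡2h
    where
    aux : ∀ h → suc m′ ≡ h * 2 → h ≤ m′
    aux (suc h) refl = s≤s (m≤m*n h 2)

  bound : suc n * sum {m} toℕ + (m + h * (ν + suc ν)) ≤ suc n * ((2 + ν) * m′)
  bound = begin
    suc n * sum {m} toℕ + (m + h * (ν + suc ν))       ≡⟨ cong₂ (λ a b → suc n * a + (b + h * (ν + suc ν))) triangle m≡2h ⟩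
    -- Here 2h + h (2ν + 1) = h (n + 1), so the factor n + 1 splits off the whole row sum.
    suc n * (h * m′) + (h * 2 + h * (ν + suc ν))      ≡⟨ regroup h m′ ν ⟩
    suc n * (h * m′ + h)                              ≤⟨ *-monoʳ-≤ (suc n) (+-mono-≤ (*-monoˡ-≤ m′ h≤ν) h≤m′) ⟩
    suc n * (suc ν * m′ + m′)                         ≡⟨ cong (suc n *_) (+-comm (suc ν * m′) m′) ⟩
    suc n * ((2 + ν) * m′)                            ∎
    where
    open ≤-Reasoning
    regroup : ∀ h m′ ν → suc (suc ν + suc ν) * (h * m′) + (h * 2 + h * (ν + suc ν)) ≡ suc (suc ν + suc ν) * (h * m′ + h)
    regroup = solve-∀

-- The riffle permutation and magic squares of odd order

natPermutation : ∀ n (f g : ℕ → ℕ) → (∀ x → x < n → f x < n) → (∀ x → x < n → g x < n) →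
  (∀ x → x < n → f (g x) ≡ x) → (∀ x → x < n → g (f x) ≡ x) → Permutation′ n
natPermutation n f g f< g< f∘g g∘f = Perm.permutation
  (λ x → F.fromℕ< (f< (toℕ x) (FP.toℕ<n x))) (λ x → F.fromℕ< (g< (toℕ x) (FP.toℕ<n x)))
  (λ x → FP.toℕ-injective (trans (FP.toℕ-fromℕ< _) (trans (cong f (FP.toℕ-fromℕ< _)) (f∘g (toℕ x) (FP.toℕ<n x)))))
  (λ x → FP.toℕ-injective (trans (FP.toℕ-fromℕ< _) (trans (cong g (FP.toℕ-fromℕ< _)) (g∘f (toℕ x) (FP.toℕ<n x)))))

halve : ∀ t → (∃ λ s → t ≡ s + s) ⊎ (∃ λ s → t ≡ suc (s + s))
halve zero    = inj₁ (0 , refl)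
halve (suc t) with halve t
... | inj₁ (s , refl) = inj₂ (s , refl)
... | inj₂ (s , refl) = inj₁ (suc s , cong suc (sym (+-suc s s)))

double≢odd : ∀ s s′ → s + s ≢ suc (s′ + s′)
double≢odd (suc s) zero     eq with () ← trans (sym (+-suc s s)) (suc-injective eq)
double≢odd (suc s) (suc s′) eq = double≢odd s s′ (suc-injective (trans (sym (+-suc s s)) (trans (suc-injective eq) (cong suc (+-suc s′ s′)))))

double-injective : ∀ s s′ → s + s ≡ s′ + s′ → s ≡ s′
double-injective s s′ eq = *-cancelˡ-≡ s s′ 2 (trans (cong (s +_) (+-identityʳ s)) (trans eq (cong (s′ +_) (sym (+-identityʳ s′)))))

-- x ↦ 2x + 1 modulo 2κ + 1.
riffle : ℕ → ℕ → ℕ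
riffle κ x with x <? κ
... | yes _ = suc (x + x)
... | no  _ = (x ∸ κ) + (x ∸ κ)

unriffle : ℕ → ℕ → ℕ
unriffle κ t with halve t
... | inj₁ (s , _) = κ + s
... | inj₂ (s , _) = s

riffle-low : ∀ κ x → x < κ → riffle κ x ≡ suc (x + x)
riffle-low κ x x<κ with x <? κ
... | yes _   = refl
... | no  x≮κ = contradiction x<κ x≮κ

riffle-high : ∀ κ j → riffle κ (κ + j) ≡ j + j
riffle-high κ j with κ + j <? κ
... | yes lt = contradiction lt (m+n≮m κ j)
... | no  _  = cong (λ x → x + x) (m+n∸m≡n κ j)

unriffle-even : ∀ κ s → unriffle κ (s + s) ≡ κ + s
unriffle-even κ s with halve (s + s)
... | inj₁ (s′ , eq) = cong (κ +_) (sym (double-injective s s′ eq))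
... | inj₂ (s′ , eq) = contradiction eq (double≢odd s s′)

unriffle-odd : ∀ κ s → unriffle κ (suc (s + s)) ≡ s
unriffle-odd κ s with halve (suc (s + s))
... | inj₁ (s′ , eq) = contradiction (sym eq) (double≢odd s′ s)
... | inj₂ (s′ , eq) = sym (double-injective s s′ (suc-injective eq))

-- `unriffle` is the zigzag κ, 0, κ + 1, 1, ..., whose neighbours add up to κ, κ + 1, κ + 2, ....
-- Numbering the cycle edges by it makes the contribution of two consecutive edges linear in the
-- vertex.
unriffle-suc : ∀ κ x → unriffle κ x + unriffle κ (suc x) ≡ κ + x
unriffle-suc κ x = go x (halve x)
  where
  regroup : ∀ κ s → s + (κ + suc s) ≡ κ + suc (s + s)
  regroup = solve-∀
  go : ∀ x → (∃ λ s → x ≡ s + s) ⊎ (∃ λ s → x ≡ suc (s + s)) → unriffle κ x + unriffle κ (suc x) ≡ κ + x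
  go _ (inj₁ (s , refl)) = trans (cong₂ _+_ (unriffle-even κ s) (unriffle-odd κ s)) (+-assoc κ s s)
  go _ (inj₂ (s , refl)) = trans (cong₂ _+_ (unriffle-odd κ s)
    (trans (cong (unriffle κ ∘ suc) (sym (+-suc s s))) (unriffle-even κ (suc s)))) (regroup κ s)

split< : ∀ {x n κ k} → n ≡ κ + k → x < n → x < κ ⊎ ∃ λ j → x ≡ κ + j × j < k
split< {x} {κ = κ} refl x<n with x <? κ
... | yes x<κ = inj₁ x<κ
... | no  x≮κ = inj₂ (x ∸ κ , sym eq , +-cancelˡ-< κ _ _ (subst (_< _) (sym eq) x<n))
  where eq = m+[n∸m]≡n (≮⇒≥ x≮κ)

double< : ∀ {κ s} → s + s < κ + suc κ → s < suc κ
double< {κ} {s} lt = ≰⇒> λ κ<s → <⇒≱ lt (+-mono-≤ (<⇒≤ κ<s) κ<s)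

odd< : ∀ {κ s} → suc (s + s) < κ + suc κ → s < κ
odd< {κ} {s} lt = ≰⇒> λ κ≤s → <⇒≱ lt (subst (_≤ suc (s + s)) (sym (+-suc κ κ)) (s≤s (+-mono-≤ κ≤s κ≤s)))

rifflePermutation : ∀ {n} κ → n ≡ κ + suc κ → Permutation′ n
rifflePermutation {n} κ n≡ = natPermutation n (riffle κ) (unriffle κ) r< u< r∘u u∘r
  where
  r< : ∀ x → x < n → riffle κ x < n
  r< x x<n with split< n≡ x<n
  ... | inj₁ x<κ = subst₂ _<_ (sym (riffle-low κ x x<κ)) (sym n≡)
    (subst (suc (x + x) <_) (sym (+-suc κ κ)) (s≤s (+-mono-<-≤ x<κ (<⇒≤ x<κ))))
  ... | inj₂ (j , refl , s≤s j≤κ) = subst₂ _<_ (sym (riffle-high κ j)) (sym n≡) (+-mono-≤-< j≤κ (s≤s j≤κ))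
  u< : ∀ t → t < n → unriffle κ t < n
  u< t t<n with halve t
  ... | inj₁ (s , refl) = subst (κ + s <_) (sym n≡) (+-monoʳ-< κ (double< (subst (s + s <_) n≡ t<n)))
  ... | inj₂ (s , refl) = <-≤-trans (odd< (subst (suc (s + s) <_) n≡ t<n)) (subst (κ ≤_) (sym n≡) (m≤m+n κ _))
  r∘u : ∀ t → t < n → riffle κ (unriffle κ t) ≡ t
  r∘u t t<n with halve t
  ... | inj₁ (s , refl) = riffle-high κ s
  ... | inj₂ (s , refl) = riffle-low κ s (odd< (subst (suc (s + s) <_) n≡ t<n))
  u∘r : ∀ x → x < n → unriffle κ (riffle κ x) ≡ x
  u∘r x x<n with split< n≡ x<n
  ... | inj₁ x<κ = trans (cong (unriffle κ) (riffle-low κ x x<κ)) (unriffle-odd κ x)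
  ... | inj₂ (j , refl , _) = trans (cong (unriffle κ) (riffle-high κ j)) (unriffle-even κ j)

toℕ-riffle : ∀ {n} κ (eq : n ≡ κ + suc κ) x → toℕ (rifflePermutation κ eq ⟨$⟩ʳ x) ≡ riffle κ (toℕ x)
toℕ-riffle κ eq x = FP.toℕ-fromℕ< _

toℕ-unriffle : ∀ {n} κ (eq : n ≡ κ + suc κ) x → toℕ (rifflePermutation κ eq ⟨$⟩ˡ x) ≡ unriffle κ (toℕ x)
toℕ-unriffle κ eq x = FP.toℕ-fromℕ< _

-- The extra rows carry the magic square with block r + v and residue 2 r + 1 + v (mod m); the residue
-- is a permutation in each column because m is odd.
stackScheme : ∀ {n m′ t} μ {layer : Fin n → ℕ} {top} → m′ ≡ μ + μ → Scheme n m′ t layer → (∀ u → layer u < top) →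
  Scheme (n + suc m′) m′ t (joinLayer (suc m′) layer top)
stackScheme {n} {m′} μ {layer} {top} m′≡ S layer<top = record
  { label↔        = stack↔
  ; rowSum-mono   = λ x y le → subst₂ _≤_ (sym (rowSum′ x)) (sym (rowSum′ y)) (R-mono (splitAt n x) (splitAt n y) le)
  ; rowSum≤colSum = λ x v → subst₂ _≤_ (sym (rowSum′ x)) (sym (colSum′ v)) (R≤C (splitAt n x) v)
  ; colour        = colour
  ; colour-colSum = λ v w eq → trans (colSum′ v) (trans (cong (_+ W) (colour-colSum v w eq)) (sym (colSum′ w)))
  ; colSum-next   = λ v eq → colSum-next v (+-cancelʳ-≡ W _ _ (trans (sym (colSum′ v)) (trans eq (colSum′ (next v)))))
  }
  where
  open Scheme S
  m = suc m′
  T₀ = sum {m} toℕ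
  -- The common row and column sum of the magic square, once it is raised by `size` above all labels
  -- of `S`.
  W = m * size + (m * T₀ + T₀)
  m≡ : m ≡ μ + suc μ
  m≡ = trans (cong suc m′≡) (sym (+-suc μ μ))

  open Latin {m} {m} (λ r → rotate (toℕ r)) (λ a → rotate (suc (toℕ a)))

  squareValue : Fin m → Fin m → ℕ
  squareValue r v = toℕ (Inverse.to square↔ (r , v))

  sum-rotate : ∀ k → sum {m} (λ x → (toℕ x + k) % m) ≡ T₀
  sum-rotate k = trans (sum-cong-≗ {m} λ x → sym (toℕ-rotate k x)) (sym (sum-permute {m} toℕ (rotate k)))

  sum-square : ∀ (a t : Fin m → ℕ) → sum a ≡ T₀ → sum t ≡ T₀ → sum (λ i → m * a i + t i) ≡ m * T₀ + T₀
  sum-square a t eqa eqt = trans (∑-distrib-+ (λ i → m * a i) t) (cong₂ _+_ (trans (sum-*ˡ m a) (cong (m *_) eqa)) eqt)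

  square-row : ∀ r → sum (λ v → squareValue r v) ≡ m * T₀ + T₀
  square-row r = trans (sum-cong-≗ (toℕ-square r)) (trans
    (sum-row r (λ a → m * toℕ a + toℕ (rotate (suc (toℕ a)) ⟨$⟩ʳ r)))
    (sum-square toℕ (λ a → toℕ (rotate (suc (toℕ a)) ⟨$⟩ʳ r)) refl
      (trans (sum-cong-≗ {m} λ a → trans (toℕ-rotate (suc (toℕ a)) r) (cong (_% m) (swap (toℕ r) (toℕ a)))) (sum-rotate (suc (toℕ r))))))
    where
    swap : ∀ x y → x + suc y ≡ y + suc x
    swap = solve-∀

  -- The residue is r + (r + v) + 1, that is (2r + 1) + v modulo m. The extra 1 in the rotation
  -- turns doubling into the riffle, so each column permutes the residues.
  residue≡riffle : ∀ r v → toℕ (residue r v) ≡ (riffle μ (toℕ r) + toℕ v) % m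
  residue≡riffle r v = begin
    toℕ (rotate (suc (toℕ (block r v))) ⟨$⟩ʳ r)      ≡⟨ toℕ-rotate (suc (toℕ (block r v))) r ⟩
    (x + suc (toℕ (block r v))) % m                  ≡⟨ cong (λ b → (x + suc b) % m) (toℕ-rotate x v) ⟩
    (x + suc ((y + x) % m)) % m                      ≡⟨ cong (_% m) (+-suc x ((y + x) % m)) ⟩
    (suc x + (y + x) % m) % m                        ≡⟨ %-+ʳ (suc x) (y + x) ⟩
    (suc x + (y + x)) % m                            ≡⟨ go (split< m≡ (FP.toℕ<n r)) ⟩
    (riffle μ x + y) % m                             ∎
    where
    open ≡-Reasoning
    x = toℕ r
    y = toℕ v
    %-+ʳ : ∀ a b → (a + b % m) % m ≡ (a + b) % m
    %-+ʳ a b = trans (%-distribˡ-+ a (b % m) m)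
      (trans (cong (λ y → (a % m + y) % m) (m%n%n≡m%n b m)) (sym (%-distribˡ-+ a b m)))
    low : ∀ x y → suc x + (y + x) ≡ suc (x + x) + y
    low = solve-∀
    high : ∀ μ j y → suc (μ + j) + (y + (μ + j)) ≡ j + j + y + (μ + suc μ)
    high = solve-∀
    go : x < μ ⊎ (∃ λ j → x ≡ μ + j × j < suc μ) → (suc x + (y + x)) % m ≡ (riffle μ x + y) % m
    go (inj₁ x<μ) = cong (_% m) (trans (low x y) (cong (_+ y) (sym (riffle-low μ x x<μ))))
    go (inj₂ (j , eq , _)) = begin
      (suc x + (y + x)) % m                  ≡⟨ cong (λ z → (suc z + (y + z)) % m) eq ⟩
      (suc (μ + j) + (y + (μ + j))) % m      ≡⟨ cong (_% m) (trans (high μ j y) (cong (j + j + y +_) (sym m≡))) ⟩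
      (j + j + y + m) % m                    ≡⟨ [m+n]%n≡m%n (j + j + y) m ⟩
      (j + j + y) % m                        ≡⟨ cong (λ z → (z + y) % m) (trans (sym (riffle-high μ j)) (cong (riffle μ) (sym eq))) ⟩
      (riffle μ x + y) % m                   ∎

  square-col : ∀ v → sum (λ r → squareValue r v) ≡ m * T₀ + T₀
  square-col v = trans (sum-cong-≗ (λ r → toℕ-square r v))
    (sum-square (λ r → toℕ (block r v)) (λ r → toℕ (residue r v))
      (trans (sum-cong-≗ {m} λ r → trans (toℕ-rotate (toℕ r) v) (cong (_% m) (+-comm (toℕ v) (toℕ r)))) (sum-rotate (toℕ v)))
      (trans (sum-cong-≗ {m} λ r → trans (residue≡riffle r v) (cong (λ z → (z + toℕ v) % m) (sym (toℕ-riffle μ m≡ r))))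
        (trans (sym (sum-permute {m} (λ x → (toℕ x + toℕ v) % m) (rifflePermutation μ m≡))) (sum-rotate (toℕ v)))))

  Old = (Fin n × Fin m) ⊎ Fin m

  regroup↔ : ((Fin (n + m) × Fin m) ⊎ Fin m) ↔ (Old ⊎ (Fin m × Fin m))
  regroup↔ = mk↔ₛ′ to from to∘from from∘to
    where
    rowOf : Fin n ⊎ Fin m → Fin m → Old ⊎ (Fin m × Fin m)
    rowOf (inj₁ u) v = inj₁ (inj₁ (u , v))
    rowOf (inj₂ s) v = inj₂ (s , v)
    to : (Fin (n + m) × Fin m) ⊎ Fin m → Old ⊎ (Fin m × Fin m)
    to (inj₁ (x , v)) = rowOf (splitAt n x) v
    to (inj₂ k)       = inj₁ (inj₂ k)
    from : Old ⊎ (Fin m × Fin m) → (Fin (n + m) × Fin m) ⊎ Fin m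
    from (inj₁ (inj₁ (u , v))) = inj₁ (u ↑ˡ m , v)
    from (inj₁ (inj₂ k))       = inj₂ k
    from (inj₂ (s , v))        = inj₁ (n ↑ʳ s , v)
    to∘from : ∀ y → to (from y) ≡ y
    to∘from (inj₁ (inj₁ (u , v))) = cong (λ s → rowOf s v) (FP.splitAt-↑ˡ n u m)
    to∘from (inj₁ (inj₂ k))       = refl
    to∘from (inj₂ (s , v))        = cong (λ s → rowOf s v) (FP.splitAt-↑ʳ n m s)
    from∘to : ∀ x → from (to x) ≡ x
    from∘to (inj₂ k)       = refl
    from∘to (inj₁ (x , v)) with splitAt n x in eq
    ... | inj₁ u = cong (λ y → inj₁ (y , v)) (FP.splitAt⁻¹-↑ˡ eq)
    ... | inj₂ s = cong (λ y → inj₁ (y , v)) (FP.splitAt⁻¹-↑ʳ eq)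

  stack↔ : ((Fin (n + m) × Fin m) ⊎ Fin m) ↔ Fin (size + m * m)
  stack↔ = (↔-sym FP.+↔⊎ ↔-∘ (label↔ ⊎-↔ square↔)) ↔-∘ regroup↔

  stackValue : (Fin (n + m) × Fin m) ⊎ Fin m → ℕ
  stackValue x = toℕ (Inverse.to stack↔ x)

  value-old : ∀ u v → stackValue (inj₁ (u ↑ˡ m , v)) ≡ value (inj₁ (u , v))
  value-old u v rewrite FP.splitAt-↑ˡ n u m = FP.toℕ-↑ˡ (Inverse.to label↔ (inj₁ (u , v))) (m * m)

  value-square : ∀ s v → stackValue (inj₁ (n ↑ʳ s , v)) ≡ size + squareValue s v
  value-square s v rewrite FP.splitAt-↑ʳ n m s = FP.toℕ-↑ʳ size (Inverse.to square↔ (s , v))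

  value-edge : ∀ k → stackValue (inj₂ k) ≡ value (inj₂ k)
  value-edge k = FP.toℕ-↑ˡ (Inverse.to label↔ (inj₂ k)) (m * m)

  sum-above : ∀ (g : Fin m → ℕ) → sum g ≡ m * T₀ + T₀ → sum (λ i → size + g i) ≡ W
  sum-above g eq = trans (∑-distrib-+ (λ _ → size) g) (cong₂ _+_ (sum-const m size) eq)

  R : Fin n ⊎ Fin m → ℕ
  R (inj₁ u) = rowSum u
  R (inj₂ _) = W

  rowSum′ : ∀ x → sum (λ v → stackValue (inj₁ (x , v))) ≡ R (splitAt n x)
  rowSum′ x = trans (cong (λ y → sum (λ v → stackValue (inj₁ (y , v)))) (sym (FP.join-splitAt n m x))) (go (splitAt n x))
    where
    go : ∀ s → sum (λ v → stackValue (inj₁ (join n m s , v))) ≡ R s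
    go (inj₁ u) = sum-cong-≗ (value-old u)
    go (inj₂ s) = trans (sum-cong-≗ (value-square s)) (sum-above (squareValue s) (square-row s))

  -- All columns gain the same amount, so their colours and their differences are those of `S`.
  colSum′ : ∀ v → sum (λ x → stackValue (inj₁ (x , v))) + (stackValue (inj₂ v) + stackValue (inj₂ (next v))) ≡ colSum v + W
  colSum′ v = begin
    sum (λ x → stackValue (inj₁ (x , v))) + (stackValue (inj₂ v) + stackValue (inj₂ (next v)))
      ≡⟨ cong₂ _+_ (trans (sum-++ n (λ x → stackValue (inj₁ (x , v))))
           (cong₂ _+_ (sum-cong-≗ (λ u → value-old u v))
             (trans (sum-cong-≗ (λ s → value-square s v)) (sum-above (λ s → squareValue s v) (square-col v)))))
           (cong₂ _+_ (value-edge v) (value-edge (next v))) ⟩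
    sum (λ u → value (inj₁ (u , v))) + W + (value (inj₂ v) + value (inj₂ (next v)))
      ≡⟨ swap (sum (λ u → value (inj₁ (u , v)))) W _ ⟩
    colSum v + W ∎
    where
    open ≡-Reasoning
    swap : ∀ a b c → a + b + c ≡ a + c + b
    swap = solve-∀

  -- An old row has m values below `size`, while the m values of a new row are at least `size`.
  R-mono : ∀ s t → [ layer , (λ _ → top) ]′ s ≤ [ layer , (λ _ → top) ]′ t → R s ≤ R t
  R-mono (inj₁ u) (inj₁ u′) le = rowSum-mono u u′ le
  R-mono (inj₁ u) (inj₂ s)  le = begin
    rowSum u                 ≤⟨ sum-mono-≤ (λ v → <⇒≤ (FP.toℕ<n (Inverse.to label↔ (inj₁ (u , v))))) ⟩
    sum {m} (λ _ → size)     ≡⟨ sum-const m size ⟩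
    m * size                 ≤⟨ m≤m+n _ _ ⟩
    W                        ∎
    where open ≤-Reasoning
  R-mono (inj₂ s) (inj₁ u)  le = contradiction (layer<top u) (≤⇒≯ le)
  R-mono (inj₂ s) (inj₂ s′) le = ≤-refl

  R≤C : ∀ s v → R s ≤ colSum v + W
  R≤C (inj₁ u) v = ≤-trans (rowSum≤colSum u v) (m≤m+n _ _)
  R≤C (inj₂ s) v = m≤n+m W (colSum v)

-- The scheme for m odd and n odd

-- How the residues of block a are listed along the rows (blocks are 0, …, 2μ): upwards (plus),
-- downwards (minus), by riffle (mid, only a = μ), or downwards on each half of the rows (low, only
-- a = μ - 1).  Blocks a and 2μ - a are oppositely oriented, and the orders of the blocks μ - 1, μ
-- and μ + 1 have constant sum, so all rows have the same residue sum.
data Kind : Set where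
  plus minus mid low : Kind

-- Index k stands for block μ - 1 - k below the centre and μ + 1 + k above it. Orientations
-- alternate with the distance; `low` stands where the pattern would put `plus` next to the centre.
belowKind aboveKind : ℕ → Kind
belowKind zero    = low
belowKind (suc k) = if isEven (suc k) then plus else minus
aboveKind k       = if isEven k then minus else plus

kind : ℕ → ℕ → Kind
kind zero    zero    = mid
kind zero    (suc a) = aboveKind a
kind (suc μ) zero    = belowKind μ
kind (suc μ) (suc a) = kind μ a

kind-centre : ∀ μ → kind μ μ ≡ mid
kind-centre zero    = refl
kind-centre (suc μ) = kind-centre μ

kind-below : ∀ a k → kind (suc (a + k)) a ≡ belowKind k
kind-below zero    k = refl
kind-below (suc a) k = kind-below a k

kind-above : ∀ μ k → kind μ (suc (μ + k)) ≡ aboveKind k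
kind-above zero    k = refl
kind-above (suc μ) k = kind-above μ k

belowColour aboveColour : ℕ → Fin 3
belowColour k = if isEven k then zero else suc (suc zero)
aboveColour k = if isEven k then suc (suc zero) else zero

-- Colours 0 and 2 alternate on either side of the central column, oppositely on the two sides; the
-- centre has the third colour 1, so that its neighbours 0 and 2 fit.
sideColour : ℕ → ℕ → Fin 3
sideColour zero    zero    = suc zero
sideColour zero    (suc a) = aboveColour a
sideColour (suc μ) zero    = belowColour μ
sideColour (suc μ) (suc a) = sideColour μ a

sideColour-centre : ∀ μ → sideColour μ μ ≡ suc zero
sideColour-centre zero    = refl
sideColour-centre (suc μ) = sideColour-centre μ

sideColour-below : ∀ a k → sideColour (suc (a + k)) a ≡ belowColour k
sideColour-below zero    k = refl
sideColour-below (suc a) k = sideColour-below a k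

sideColour-above : ∀ μ k → sideColour μ (suc (μ + k)) ≡ aboveColour k
sideColour-above zero    k = refl
sideColour-above (suc μ) k = sideColour-above μ k

sideColour-suc : ∀ μ a → sideColour μ a ≢ sideColour μ (suc a)
sideColour-suc zero zero ()
sideColour-suc zero (suc a) eq with isEven a | isEven (suc a) | isEven-suc a
sideColour-suc zero (suc a) () | true  | _ | refl
sideColour-suc zero (suc a) () | false | _ | refl
sideColour-suc (suc zero) zero ()
sideColour-suc (suc (suc μ)) zero eq with isEven μ | isEven (suc μ) | isEven-suc μ
sideColour-suc (suc (suc μ)) zero () | true  | _ | refl
sideColour-suc (suc (suc μ)) zero () | false | _ | refl
sideColour-suc (suc μ) (suc a) eq = sideColour-suc μ a eq

-- Needed where the cycle closes: columns 2μ and 0 are equally far from the centre, on opposite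
-- sides.
below≢above : ∀ k → aboveColour k ≢ belowColour k
below≢above k eq with isEven k
below≢above k () | true
below≢above k () | false

sum-last : ∀ n (f : ℕ → ℕ) → sum {suc n} (f ∘ toℕ) ≡ sum {n} (f ∘ toℕ) + f n
sum-last zero    f = +-identityʳ (f 0)
sum-last (suc n) f = trans (cong (f 0 +_) (sum-last n (f ∘ suc))) (sym (+-assoc (f 0) _ _))

-- Removing the first and the last block, which are oppositely oriented, lowers μ by one. What
-- remains in the end is the central triple `low`, `mid`, `minus`.
sum-kind : ∀ (x : Kind → ℕ) μ →
  sum {suc (suc μ + suc μ)} (x ∘ kind (suc μ) ∘ toℕ) ≡ x low + x mid + x minus + μ * (x plus + x minus)
sum-kind x μ = trans (peel μ) (go μ)
  where
  S : ℕ → ℕ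
  S μ = sum {suc (μ + μ)} (x ∘ kind μ ∘ toℕ)
  peel : ∀ μ → S (suc μ) ≡ x (belowKind μ) + (S μ + x (aboveKind μ))
  peel μ = cong (x (belowKind μ) +_) (begin
    sum {suc (μ + suc μ)} (x ∘ kind μ ∘ toℕ)       ≡⟨ cong (λ n → sum {suc n} (x ∘ kind μ ∘ toℕ)) (+-suc μ μ) ⟩
    sum {suc (suc (μ + μ))} (x ∘ kind μ ∘ toℕ)     ≡⟨ sum-last (suc (μ + μ)) (x ∘ kind μ) ⟩
    S μ + x (kind μ (suc (μ + μ)))                 ≡⟨ cong (λ k → S μ + x k) (kind-above μ μ) ⟩
    S μ + x (aboveKind μ)                          ∎)
    where open ≡-Reasoning
  pair : ∀ μ → x (belowKind (suc μ)) + x (aboveKind (suc μ)) ≡ x plus + x minus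
  pair μ with isEven (suc μ)
  ... | true  = refl
  ... | false = +-comm (x minus) (x plus)
  go : ∀ μ → x (belowKind μ) + (S μ + x (aboveKind μ)) ≡ x low + x mid + x minus + μ * (x plus + x minus)
  go zero    = solve₀ (x low) (x mid) (x minus)
    where
    solve₀ : ∀ a b c → a + (b + 0 + c) ≡ a + b + c + 0
    solve₀ = solve-∀
  go (suc μ) = begin
    x (belowKind (suc μ)) + (S (suc μ) + x (aboveKind (suc μ)))      ≡⟨ swap (x (belowKind (suc μ))) (S (suc μ)) _ ⟩
    S (suc μ) + (x (belowKind (suc μ)) + x (aboveKind (suc μ)))      ≡⟨ cong₂ _+_ (trans (peel μ) (go μ)) (pair μ) ⟩
    x low + x mid + x minus + μ * P + P                              ≡⟨ trans (+-assoc (x low + x mid + x minus) (μ * P) P) (cong (x low + x mid + x minus +_) (+-comm (μ * P) P)) ⟩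
    x low + x mid + x minus + suc μ * P                              ∎
    where
    open ≡-Reasoning
    P = x plus + x minus
    swap : ∀ a b c → a + (b + c) ≡ b + (a + c)
    swap = solve-∀

-- The edge blocks satisfy e(v) + e(v + 1) = 3μ - v.  The κ lower rows have block 2μ - v in column v
-- and the κ + 1 upper rows have block v, so the blocks at every cycle vertex total (2κ + 3)μ.
oddScheme : ∀ κ μ₀ {m′} (layer : Fin (κ + suc κ) → ℕ) → m′ ≡ suc μ₀ + suc μ₀ → suc μ₀ ≤ κ → Scheme (κ + suc κ) m′ 3 layer
oddScheme κ μ₀ layer refl μ≤κ = latinScheme layer blk (λ a → orient (kind μ (toℕ a))) e colour D
  rows blocks cols distinct bound
  where
  μ = suc μ₀
  n = κ + suc κ
  m′ = μ + μ
  m = suc m′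
  m≡ : m ≡ μ + suc μ
  m≡ = sym (+-suc μ μ)

  lowPermutation : Permutation′ n
  lowPermutation = (↔-sym FP.+↔⊎ ↔-∘ (Perm.reverse ⊎-↔ Perm.reverse)) ↔-∘ FP.+↔⊎ {κ}

  orient : Kind → Permutation′ n
  orient plus  = Perm.id
  orient minus = Perm.reverse
  orient mid   = rifflePermutation κ refl
  orient low   = lowPermutation

  low-lower : ∀ i → toℕ (lowPermutation ⟨$⟩ʳ (i ↑ˡ suc κ)) ≡ toℕ (F.opposite i)
  low-lower i rewrite FP.splitAt-↑ˡ κ i (suc κ) = FP.toℕ-↑ˡ (F.opposite i) (suc κ)

  low-upper : ∀ j → toℕ (lowPermutation ⟨$⟩ʳ (κ ↑ʳ j)) ≡ κ + toℕ (F.opposite j)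
  low-upper j rewrite FP.splitAt-↑ʳ κ (suc κ) j = FP.toℕ-↑ʳ κ (F.opposite j)

  mid-lower : ∀ (i : Fin κ) → toℕ (orient mid ⟨$⟩ʳ (i ↑ˡ suc κ)) ≡ suc (toℕ i + toℕ i)
  mid-lower i = trans (toℕ-riffle κ refl (i ↑ˡ suc κ))
    (trans (cong (riffle κ) (FP.toℕ-↑ˡ i (suc κ))) (riffle-low κ (toℕ i) (FP.toℕ<n i)))

  mid-upper : ∀ (j : Fin (suc κ)) → toℕ (orient mid ⟨$⟩ʳ (κ ↑ʳ j)) ≡ toℕ j + toℕ j
  mid-upper j = trans (toℕ-riffle κ refl (κ ↑ʳ j))
    (trans (cong (riffle κ) (FP.toℕ-↑ʳ κ j)) (riffle-high κ (toℕ j)))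

  minus-lower : ∀ (i : Fin κ) → toℕ (F.opposite (i ↑ˡ suc κ)) + toℕ i ≡ κ + κ
  minus-lower i = suc-injective (trans (sym (+-suc _ (toℕ i)))
    (trans (cong (λ x → toℕ (F.opposite (i ↑ˡ suc κ)) + suc x) (sym (FP.toℕ-↑ˡ i (suc κ)))) (trans (opposite+ (i ↑ˡ suc κ)) (+-suc κ κ))))

  minus-upper : ∀ (j : Fin (suc κ)) → toℕ (F.opposite (κ ↑ʳ j)) + toℕ j ≡ κ
  minus-upper j = +-cancelˡ-≡ (suc κ) _ _ (trans (regroup κ (toℕ (F.opposite (κ ↑ʳ j))) (toℕ j))
    (trans (cong (λ x → toℕ (F.opposite (κ ↑ʳ j)) + suc x) (sym (FP.toℕ-↑ʳ κ j))) (trans (opposite+ (κ ↑ʳ j)) (+-suc κ κ))))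
    where
    regroup : ∀ κ o j → suc κ + (o + j) ≡ o + suc (κ + j)
    regroup = solve-∀

  -- Within each half of the rows `mid` climbs by 2 per row while `low` and `minus` each fall by 1.
  -- The halves are matched so that both constants are 3κ, three times the mean residue.
  triple : ∀ r → toℕ (orient low ⟨$⟩ʳ r) + toℕ (orient mid ⟨$⟩ʳ r) + toℕ (orient minus ⟨$⟩ʳ r) ≡ κ + (κ + κ)
  triple r = subst P (FP.join-splitAt κ (suc κ) r) (go (splitAt κ r))
    where
    P : Fin n → Set
    P r = toℕ (orient low ⟨$⟩ʳ r) + toℕ (orient mid ⟨$⟩ʳ r) + toℕ (orient minus ⟨$⟩ʳ r) ≡ κ + (κ + κ)
    lower-regroup : ∀ p i o → p + suc (i + i) + o ≡ p + suc i + (o + i)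
    lower-regroup = solve-∀
    upper-regroup : ∀ κ p j o → κ + p + (j + j) + o ≡ κ + (p + j + (o + j))
    upper-regroup = solve-∀
    go : ∀ s → P (join κ (suc κ) s)
    go (inj₁ i) = trans (cong₂ (λ x y → x + y + toℕ (F.opposite (i ↑ˡ suc κ))) (low-lower i) (mid-lower i))
      (trans (lower-regroup (toℕ (F.opposite i)) (toℕ i) _) (cong₂ _+_ (opposite+ i) (minus-lower i)))
    go (inj₂ j) = trans (cong₂ (λ x y → x + y + toℕ (F.opposite (κ ↑ʳ j))) (low-upper j) (mid-upper j))
      (trans (upper-regroup κ (toℕ (F.opposite j)) (toℕ j) _)
        (cong (κ +_) (cong₂ _+_ (suc-injective (trans (sym (+-suc _ (toℕ j))) (opposite+ j))) (minus-upper j))))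

  plus+minus : ∀ (r : Fin n) → toℕ r + toℕ (F.opposite r) ≡ κ + κ
  plus+minus r = suc-injective (trans (+-comm (suc (toℕ r)) _) (trans (opposite+ r) (+-suc κ κ)))

  rows : ∀ r → sum {m} (λ a → toℕ (orient (kind μ (toℕ a)) ⟨$⟩ʳ r)) ≡ κ + (κ + κ) + μ₀ * (κ + κ)
  rows r = trans (sum-kind (λ k → toℕ (orient k ⟨$⟩ʳ r)) μ₀) (cong₂ (λ x y → x + μ₀ * y) (triple r) (plus+minus r))

  lower upper : Kind → ℕ
  lower k = sum {κ} (λ i → toℕ (orient k ⟨$⟩ʳ (i ↑ˡ suc κ)))
  upper k = sum {suc κ} (λ j → toℕ (orient k ⟨$⟩ʳ (κ ↑ʳ j)))

  -- Reversal inside a half keeps the sum of that half. Hence `low` counts as `plus` in the columns,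
  -- and only the row sums see the difference.
  lower-low : lower low ≡ lower plus
  lower-low = trans (sum-cong-≗ {κ} low-lower) (trans (sum-opposite κ) (sum-cong-≗ {κ} λ i → sym (FP.toℕ-↑ˡ i (suc κ))))

  upper-low : upper low ≡ upper plus
  upper-low = trans (sum-cong-≗ {suc κ} low-upper) (trans (∑-distrib-+ {suc κ} (λ _ → κ) (toℕ ∘ F.opposite))
    (trans (cong (sum {suc κ} (λ _ → κ) +_) (sum-opposite (suc κ)))
      (trans (sym (∑-distrib-+ {suc κ} (λ _ → κ) toℕ)) (sum-cong-≗ {suc κ} λ j → sym (FP.toℕ-↑ʳ κ j)))))

  -- The central column has block μ in all rows, so its residues form one full permutation. Its
  -- total, equal to that of `plus`, lies strictly between the other two column totals.
  mid-total : lower mid + upper mid ≡ lower plus + upper plus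
  mid-total = trans (sym (sum-++ κ (λ r → toℕ (orient mid ⟨$⟩ʳ r))))
    (trans (sym (sum-permute {n} toℕ (orient mid))) (sum-++ κ toℕ))

  D : Fin 3 → ℕ
  D zero             = lower minus + upper plus
  D (suc zero)       = lower mid + upper mid
  D (suc (suc zero)) = lower plus + upper minus

  lower-< : lower plus < lower minus
  lower-< = sum-mono-< {κ} {λ i → toℕ (i ↑ˡ suc κ)} {λ i → toℕ (F.opposite (i ↑ˡ suc κ))} (<⇒≤ ∘ term)
    (F.fromℕ< (≤-trans (s≤s z≤n) μ≤κ)) (term _)
    where
    term : ∀ i → toℕ (i ↑ˡ suc κ) < toℕ (F.opposite (i ↑ˡ suc κ))
    term i = +-cancelʳ-< (toℕ i) _ _ (begin-strict
      toℕ (i ↑ˡ suc κ) + toℕ i    ≡⟨ cong (_+ toℕ i) (FP.toℕ-↑ˡ i (suc κ)) ⟩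
      toℕ i + toℕ i               <⟨ +-mono-<-≤ (FP.toℕ<n i) (<⇒≤ (FP.toℕ<n i)) ⟩
      κ + κ                       ≡⟨ minus-lower i ⟨
      _                           ∎)
      where open ≤-Reasoning

  upper-< : upper minus < upper plus
  -- Row κ is its own mirror image and gives equality; the last row gives strictness.
  upper-< = sum-mono-< {suc κ} {λ j → toℕ (F.opposite (κ ↑ʳ j))} {λ j → toℕ (κ ↑ʳ j)} term (F.fromℕ κ) at-top
    where
    open ≤-Reasoning
    minus≤κ : ∀ (j : Fin (suc κ)) → toℕ (F.opposite (κ ↑ʳ j)) ≤ κ
    minus≤κ j = ≤-trans (m≤m+n _ (toℕ j)) (≤-reflexive (minus-upper j))
    term : ∀ (j : Fin (suc κ)) → toℕ (F.opposite (κ ↑ʳ j)) ≤ toℕ (κ ↑ʳ j)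
    term j = ≤-trans (minus≤κ j) (≤-trans (m≤m+n κ (toℕ j)) (≤-reflexive (sym (FP.toℕ-↑ʳ κ j))))
    at-top : toℕ (F.opposite (κ ↑ʳ F.fromℕ κ)) < toℕ (κ ↑ʳ F.fromℕ κ)
    at-top = begin-strict
      toℕ (F.opposite (κ ↑ʳ F.fromℕ κ))  ≤⟨ minus≤κ (F.fromℕ κ) ⟩
      κ                                  <⟨ m<m+n κ (≤-trans (s≤s z≤n) μ≤κ) ⟩
      κ + κ                              ≡⟨ cong (κ +_) (FP.toℕ-fromℕ κ) ⟨
      κ + toℕ (F.fromℕ κ)                ≡⟨ FP.toℕ-↑ʳ κ (F.fromℕ κ) ⟨
      toℕ (κ ↑ʳ F.fromℕ κ)               ∎

  D₀>D₁ : D (suc zero) < D zero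
  D₀>D₁ = subst (_< D zero) (sym mid-total) (+-monoˡ-< (upper plus) lower-<)

  D₁>D₂ : D (suc (suc zero)) < D (suc zero)
  D₁>D₂ = subst (D (suc (suc zero)) <_) (sym mid-total) (+-monoʳ-< (lower plus) upper-<)

  D-injective : ∀ x y → D x ≡ D y → x ≡ y
  D-injective zero             zero             _  = refl
  D-injective zero             (suc zero)       eq = contradiction (sym eq) (<⇒≢ D₀>D₁)
  D-injective zero             (suc (suc zero)) eq = contradiction (sym eq) (<⇒≢ (<-trans D₁>D₂ D₀>D₁))
  D-injective (suc zero)       zero             eq = contradiction eq (<⇒≢ D₀>D₁)
  D-injective (suc zero)       (suc zero)       _  = refl
  D-injective (suc zero)       (suc (suc zero)) eq = contradiction (sym eq) (<⇒≢ D₁>D₂)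
  D-injective (suc (suc zero)) zero             eq = contradiction eq (<⇒≢ (<-trans D₁>D₂ D₀>D₁))
  D-injective (suc (suc zero)) (suc zero)       eq = contradiction eq (<⇒≢ D₁>D₂)
  D-injective (suc (suc zero)) (suc (suc zero)) _  = refl

  colour : Fin m → Fin 3
  colour v = sideColour μ (toℕ v)

  distinct : ∀ v → D (colour v) ≢ D (colour (next v))
  distinct v eq = go v (D-injective _ _ eq)
    where
    go : ∀ v → colour v ≢ colour (next v)
    go v eq with view v
    ... | ‵inject₁ j = sideColour-suc μ (toℕ j) (trans (cong (sideColour μ) (sym (FP.toℕ-inject₁ j)))
      (trans eq (cong (sideColour μ ∘ toℕ) (next-prev (suc j)))))
    ... | ‵fromℕ = below≢above μ₀ (begin
      aboveColour μ₀                       ≡⟨ sideColour-above μ μ₀ ⟨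
      sideColour μ (suc (μ + μ₀))          ≡⟨ cong (sideColour μ) (sym (trans (FP.toℕ-fromℕ m′) (+-suc μ μ₀))) ⟩
      colour (F.fromℕ m′)                  ≡⟨ eq ⟩
      colour (next (F.fromℕ m′))           ≡⟨ cong colour (next-prev (zero {m′})) ⟩
      belowColour μ₀                       ∎)
      where open ≡-Reasoning

  below-side : ∀ k → lower (aboveKind k) + upper (belowKind k) ≡ D (belowColour k)
  below-side zero    = cong (lower minus +_) upper-low
  below-side (suc k) with isEven (suc k)
  ... | true  = refl
  ... | false = refl

  above-side : ∀ k → lower (belowKind k) + upper (aboveKind k) ≡ D (aboveColour k)
  above-side zero    = cong (_+ upper minus) lower-low
  above-side (suc k) with isEven (suc k)
  ... | true  = refl
  ... | false = refl

  mirror-below : ∀ a k ā → ā + a ≡ suc (a + k) + suc (a + k) → ā ≡ suc (suc (a + k) + k)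
  mirror-below a k ā eq = +-cancelʳ-≡ a _ _ (trans eq (regroup a k))
    where
    regroup : ∀ a k → suc (a + k) + suc (a + k) ≡ suc (suc (a + k) + k) + a
    regroup = solve-∀

  mirror-above : ∀ μ k ā → ā + suc (μ + k) ≡ μ + μ → μ ≡ suc (ā + k)
  mirror-above μ k ā eq = +-cancelʳ-≡ μ _ _ (trans (sym eq) (regroup ā k μ))
    where
    regroup : ∀ ā k μ → ā + suc (μ + k) ≡ suc (ā + k) + μ
    regroup = solve-∀

  -- The lower rows of a column have the block mirrored at μ, of opposite orientation, so both
  -- halves of the rows push the column total the same way.
  side : ∀ μ a ā → ā + a ≡ μ + μ → lower (kind μ ā) + upper (kind μ a) ≡ D (sideColour μ a)
  side μ a ā eq with compare a μ
  ... | equal _ rewrite +-cancelʳ-≡ a ā a eq | kind-centre a | sideColour-centre a = refl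
  ... | less a k rewrite mirror-below a k ā eq
                       | kind-above (a + k) k | kind-below a k | sideColour-below a k = below-side k
  ... | greater μ k with refl ← mirror-above μ k ā eq
    rewrite kind-below ā k | kind-above (ā + k) k | sideColour-above (ā + k) k = above-side k

  pick : Fin κ ⊎ Fin (suc κ) → Permutation′ m
  pick (inj₁ _) = Perm.reverse
  pick (inj₂ _) = Perm.id

  blk : Fin n → Permutation′ m
  blk r = pick (splitAt κ r)

  blk-lower : ∀ i → blk (i ↑ˡ suc κ) ≡ Perm.reverse
  blk-lower i = cong pick (FP.splitAt-↑ˡ κ i (suc κ))

  blk-upper : ∀ j → blk (κ ↑ʳ j) ≡ Perm.id
  blk-upper j = cong pick (FP.splitAt-↑ʳ κ (suc κ) j)

  opposite′ : ∀ (v : Fin m) → toℕ (F.opposite v) + toℕ v ≡ μ + μ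
  opposite′ v = suc-injective (trans (sym (+-suc _ _)) (opposite+ v))

  cols : ∀ v → sum (λ r → toℕ (orient (kind μ (toℕ (blk r ⟨$⟩ʳ v))) ⟨$⟩ʳ r)) ≡ D (colour v)
  cols v = trans (sum-++ κ (λ r → toℕ (orient (kind μ (toℕ (blk r ⟨$⟩ʳ v))) ⟨$⟩ʳ r))) (trans (cong₂ _+_
    (sum-cong-≗ {κ} λ i → cong (λ π → toℕ (orient (kind μ (toℕ (π ⟨$⟩ʳ v))) ⟨$⟩ʳ (i ↑ˡ suc κ))) (blk-lower i))
    (sum-cong-≗ {suc κ} λ j → cong (λ π → toℕ (orient (kind μ (toℕ (π ⟨$⟩ʳ v))) ⟨$⟩ʳ (κ ↑ʳ j))) (blk-upper j)))
    (side μ (toℕ v) (toℕ (F.opposite v)) (opposite′ v)))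

  -- The upper half has one row more than the lower, which leaves one block v unpaired in column v.
  -- Consecutive values of `unriffle` add up to μ + v, so its mirror image 2μ - `unriffle` on the
  -- two cycle edges cancels this v.
  e : Permutation′ m
  e = Perm.flip (rifflePermutation μ m≡) ∘ₚ Perm.reverse

  e+unriffle : ∀ v → toℕ (e ⟨$⟩ʳ v) + unriffle μ (toℕ v) ≡ μ + μ
  e+unriffle v = trans (cong (toℕ (e ⟨$⟩ʳ v) +_) (sym (toℕ-unriffle μ m≡ v))) (opposite′ (rifflePermutation μ m≡ ⟨$⟩ˡ v))

  -- The zigzag closes up: its last value 2μ and its first value μ add up to 3μ, which is μ + v at
  -- the last vertex v = 2μ.
  unriffle-next : ∀ (v : Fin m) → unriffle μ (toℕ v) + unriffle μ (toℕ (next v)) ≡ μ + toℕ v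
  unriffle-next v with view v
  ... | ‵inject₁ j = trans
    (cong₂ (λ x y → unriffle μ x + unriffle μ y) (FP.toℕ-inject₁ j) (cong toℕ (next-prev (suc j))))
    (trans (unriffle-suc μ (toℕ j)) (cong (μ +_) (sym (FP.toℕ-inject₁ j))))
  ... | ‵fromℕ = trans
    (cong₂ (λ x y → unriffle μ x + unriffle μ y) (FP.toℕ-fromℕ m′) (cong toℕ (next-prev (zero {m′}))))
    (trans (cong₂ _+_ (unriffle-even μ μ) (unriffle-even μ 0))
      (trans (cong (μ + μ +_) (+-identityʳ μ)) (trans (+-assoc μ μ μ) (cong (μ +_) (sym (FP.toℕ-fromℕ m′))))))

  e-sum : ∀ v → toℕ v + (toℕ (e ⟨$⟩ʳ v) + toℕ (e ⟨$⟩ʳ next v)) ≡ μ + (μ + μ)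
  e-sum v = +-cancelʳ-≡ μ _ _ (begin
    toℕ v + (x + y) + μ        ≡⟨ regroup₁ (toℕ v) x y μ ⟩
    x + y + (μ + toℕ v)        ≡⟨ cong (x + y +_) (unriffle-next v) ⟨
    x + y + (x̄ + ȳ)            ≡⟨ regroup₂ x y x̄ ȳ ⟩
    (x + x̄) + (y + ȳ)          ≡⟨ cong₂ _+_ (e+unriffle v) (e+unriffle (next v)) ⟩
    (μ + μ) + (μ + μ)          ≡⟨ regroup₃ μ ⟩
    μ + (μ + μ) + μ            ∎)
    where
    open ≡-Reasoning
    x = toℕ (e ⟨$⟩ʳ v)
    y = toℕ (e ⟨$⟩ʳ next v)
    x̄ = unriffle μ (toℕ v)
    ȳ = unriffle μ (toℕ (next v))
    regroup₁ : ∀ v x y μ → v + (x + y) + μ ≡ x + y + (μ + v)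
    regroup₁ = solve-∀
    regroup₂ : ∀ x y x̄ ȳ → x + y + (x̄ + ȳ) ≡ (x + x̄) + (y + ȳ)
    regroup₂ = solve-∀
    regroup₃ : ∀ μ → (μ + μ) + (μ + μ) ≡ μ + (μ + μ) + μ
    regroup₃ = solve-∀

  blocks : ∀ v → sum (λ r → toℕ (blk r ⟨$⟩ʳ v)) + (toℕ (e ⟨$⟩ʳ v) + toℕ (e ⟨$⟩ʳ next v)) ≡ (κ + κ + 3) * μ
  blocks v = begin
    sum (λ r → toℕ (blk r ⟨$⟩ʳ v)) + E
      ≡⟨ cong (_+ E) (trans (sum-++ κ (λ r → toℕ (blk r ⟨$⟩ʳ v))) (cong₂ _+_
          (trans (sum-cong-≗ {κ} λ i → cong (λ π → toℕ (π ⟨$⟩ʳ v)) (blk-lower i)) (sum-const κ x̄))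
          (trans (sum-cong-≗ {suc κ} λ j → cong (λ π → toℕ (π ⟨$⟩ʳ v)) (blk-upper j)) (sum-const (suc κ) x)))) ⟩
    κ * x̄ + suc κ * x + E          ≡⟨ regroup₁ κ x x̄ E ⟩
    κ * (x̄ + x) + (x + E)          ≡⟨ cong₂ (λ a b → κ * a + b) (opposite′ v) (e-sum v) ⟩
    κ * (μ + μ) + (μ + (μ + μ))    ≡⟨ regroup₂ κ μ ⟩
    (κ + κ + 3) * μ                ∎
    where
    open ≡-Reasoning
    x = toℕ v
    x̄ = toℕ (F.opposite v)
    E = toℕ (e ⟨$⟩ʳ v) + toℕ (e ⟨$⟩ʳ next v)
    regroup₁ : ∀ κ x x̄ E → κ * x̄ + suc κ * x + E ≡ κ * (x̄ + x) + (x + E)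
    regroup₁ = solve-∀
    regroup₂ : ∀ κ μ → κ * (μ + μ) + (μ + (μ + μ)) ≡ (κ + κ + 3) * μ
    regroup₂ = solve-∀

  triangle : sum {m} toℕ ≡ μ * m
  triangle = *-cancelʳ-≡ _ _ 2 (+-cancelʳ-≡ m _ _ (begin
    sum {m} toℕ * 2 + m              ≡⟨ cong (_+ m) (trans (*-comm (sum {m} toℕ) 2) (cong (sum {m} toℕ +_) (+-identityʳ _))) ⟩
    sum {m} toℕ + sum {m} toℕ + m    ≡⟨ sum-toℕ m ⟩
    m * m                            ≡⟨ regroup μ ⟩
    μ * m * 2 + m                    ∎))
    where
    open ≡-Reasoning
    regroup : ∀ μ → suc (μ + μ) * suc (μ + μ) ≡ μ * suc (μ + μ) * 2 + suc (μ + μ)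
    regroup = solve-∀

  bound : suc n * sum {m} toℕ + (m + (κ + (κ + κ) + μ₀ * (κ + κ))) ≤ suc n * ((κ + κ + 3) * μ)
  bound = begin
    suc n * sum {m} toℕ + (m + (κ + (κ + κ) + μ₀ * (κ + κ)))   ≡⟨ cong (λ t → suc n * t + (m + (κ + (κ + κ) + μ₀ * (κ + κ)))) triangle ⟩
    suc n * (μ * m) + (m + (κ + (κ + κ) + μ₀ * (κ + κ)))       ≡⟨ regroup₁ κ μ₀ ⟩
    -- Since 3 + 2μ₀ = m, the row sum collapses to (κ + 1) m². The added 2μ - 1 completes m² to 2μ
    -- (2μ + 3), and μ ≤ κ finishes the comparison.
    suc κ * (m * m)                                            ≤⟨ *-monoʳ-≤ (suc κ) (m≤m+n (m * m) (suc (μ₀ + μ₀))) ⟩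
    suc κ * (m * m + suc (μ₀ + μ₀))                            ≡⟨ regroup₂ κ μ₀ ⟩
    suc n * ((μ + μ + 3) * μ)                                  ≤⟨ *-monoʳ-≤ (suc n) (*-monoˡ-≤ μ (+-monoˡ-≤ 3 (+-mono-≤ μ≤κ μ≤κ))) ⟩
    suc n * ((κ + κ + 3) * μ)                                  ∎
    where
    open ≤-Reasoning
    regroup₁ : ∀ κ μ₀ → suc (κ + suc κ) * (suc μ₀ * suc (suc μ₀ + suc μ₀)) + (suc (suc μ₀ + suc μ₀) + (κ + (κ + κ) + μ₀ * (κ + κ)))
      ≡ suc κ * (suc (suc μ₀ + suc μ₀) * suc (suc μ₀ + suc μ₀))
    regroup₁ = solve-∀
    regroup₂ : ∀ κ μ₀ → suc κ * (suc (suc μ₀ + suc μ₀) * suc (suc μ₀ + suc μ₀) + suc (μ₀ + μ₀))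
      ≡ suc (κ + suc κ) * ((suc μ₀ + suc μ₀ + 3) * suc μ₀)
    regroup₂ = solve-∀

-- The iterated join and the theorem

iterOrder≡ : ∀ p m k → iterOrder p m k ≡ p + k * m
iterOrder≡ p m zero    = sym (+-identityʳ p)
iterOrder≡ p m (suc k) = trans (cong (_+ m) (iterOrder≡ p m k)) (trans (+-assoc p (k * m) m) (cong (p +_) (+-comm (k * m) m)))

iterJoin-regular : ∀ {p d l} {G : Graph p} → IsRegular G d → d + (3 + l) ≡ p + 2 →
  ∀ k → IsRegular (iterJoin G (3 + l) k) (d + k * (3 + l))
iterJoin-regular {d = d} regular order zero u = trans (regular u) (sym (+-identityʳ d))
iterJoin-regular {p} {d} {l} {G} regular order (suc k) x =
  subst (λ y → degree (H ∨G cycle m) y ≡ d + suc k * m) (FP.join-splitAt (iterOrder p m k) m x)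
    (go (splitAt (iterOrder p m k) x))
  where
  open ≡-Reasoning
  m = 3 + l
  H = iterJoin G m k
  go : ∀ s → degree (H ∨G cycle m) (join (iterOrder p m k) m s) ≡ d + suc k * m
  go (inj₁ u) = begin
    degree (H ∨G cycle m) (u ↑ˡ m)   ≡⟨ degree-joinˡ H (cycle m) u ⟩
    degree H u + m                   ≡⟨ cong (_+ m) (iterJoin-regular {G = G} regular order k u) ⟩
    d + k * m + m                    ≡⟨ +-assoc d (k * m) m ⟩
    d + (k * m + m)                  ≡⟨ cong (d +_) (+-comm (k * m) m) ⟩
    d + suc k * m                    ∎
  go (inj₂ v) = begin
    degree (H ∨G cycle m) (iterOrder p m k ↑ʳ v)   ≡⟨ degree-joinʳ H (cycle m) v ⟩
    iterOrder p m k + degree (cycle m) v           ≡⟨ cong₂ _+_ (iterOrder≡ p m k) (cycle-regular l v) ⟩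
    p + k * m + 2                                  ≡⟨ swap p (k * m) 2 ⟩
    p + 2 + k * m                                  ≡⟨ cong (_+ k * m) order ⟨
    d + m + k * m                                  ≡⟨ +-assoc d m (k * m) ⟩
    d + suc k * m                                  ∎
    where
    swap : ∀ a b c → a + b + c ≡ a + c + b
    swap = solve-∀

iterLayer : ∀ p m k → Fin (iterOrder p m k) → ℕ
iterLayer p m zero    _ = 0
iterLayer p m (suc k)   = joinLayer m (iterLayer p m k) (suc k)

iterLayer< : ∀ p m k u → iterLayer p m k u < suc k
iterLayer< p m zero    u = s≤s z≤n
iterLayer< p m (suc k) x with splitAt (iterOrder p m k) x
... | inj₁ u = m<n⇒m<1+n (iterLayer< p m k u)
... | inj₂ _ = ≤-refl

iterLabeling : ∀ {p d l c t} {G : Graph p} → IsRegular G (suc d) → suc d + (3 + l) ≡ p + 2 →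
  (∀ k → Scheme (iterOrder p (3 + l) k) (2 + l) t (iterLayer p (3 + l) k)) → LayeredLabeling G (λ _ → 0) c →
  ∀ k → LayeredLabeling (iterJoin G (3 + l) k) (iterLayer p (3 + l) k) (c + t * k)
iterLabeling {c = c} {t} {G} regular order schemes L zero =
  subst (LayeredLabeling G (λ _ → 0)) (sym (trans (cong (c +_) (*-zeroʳ t)) (+-identityʳ c))) L
iterLabeling {p} {d} {l} {c} {t} {G} regular order schemes L (suc k) =
  subst (LayeredLabeling (iterJoin G m (suc k)) (iterLayer p m (suc k)))
    (trans (+-assoc c (t * k) t) (cong (c +_) (trans (+-comm (t * k) t) (sym (*-suc t k)))))
    (extend (iterLabeling {G = G} regular order schemes L k) (schemes k) (iterLayer< p m k)
      (iterJoin-regular {G = G} regular order k) order′)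
  where
  m = 3 + l
  order′ : suc d + k * m + m ≡ iterOrder p m k + 2
  order′ = begin
    suc d + k * m + m        ≡⟨ swap (suc d) (k * m) m ⟩
    suc d + m + k * m        ≡⟨ cong (_+ k * m) order ⟩
    p + 2 + k * m            ≡⟨ swap p 2 (k * m) ⟩
    p + k * m + 2            ≡⟨ cong (_+ 2) (iterOrder≡ p m k) ⟨
    iterOrder p m k + 2      ∎
    where
    open ≡-Reasoning
    swap : ∀ a b c → a + b + c ≡ a + c + b
    swap = solve-∀

baseLabeling : ∀ {n c} {G : Graph n} → IsLocalAntimagicChromaticNumber G c → LayeredLabeling G (λ _ → 0) c
baseLabeling {n} ((f , anti , refl) , _) = record
  { labeling     = f
  ; antimagic    = anti
  ; layer-vsum   = λ _ _ ()
  ; colour       = λ u → index (vsum∈values f u)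
  ; colour-vsum  = λ u v eq → trans (lookup-index (vsum∈values f u))
      (trans (cong (lookup (deduplicate _≟_ (map (vsum f) (allFin n)))) eq) (sym (lookup-index (vsum∈values f v))))
  ; colour-layer = λ _ _ _ → refl
  }

-- The colouring bound is used twice: on this labeling, so that its K colours give exactly K values,
-- and on an arbitrary one, for minimality.
layered⇒χla : ∀ {n K} {G : Graph n} {layer} → LayeredLabeling G layer K → (∀ M → ProperColouring G M → K ≤ M) →
  IsLocalAntimagicChromaticNumber G K
layered⇒χla L lower = (labeling , antimagic , ≤-antisym (numValues≤ labeling colour colour-vsum) (bound labeling antimagic)) , bound
  where
  open LayeredLabeling L
  bound : ∀ f → IsLocalAntimagic f → _ ≤ numValues f
  bound f anti = lower (numValues f) (localAntimagic⇒colouring f anti)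

-- Identifies a given value of χ_la(G) with the one that the hypothesis equates with χ(G), so that
-- the colouring bound carries over.
χla-unique : ∀ {n} {G : Graph n} {c c′} → IsLocalAntimagicChromaticNumber G c → IsLocalAntimagicChromaticNumber G c′ → c ≡ c′
χla-unique ((f , anti , refl) , least) ((f′ , anti′ , refl) , least′) = ≤-antisym (least f′ anti′) (least′ f anti)

even-order-scheme : ∀ {n m′} (layer : Fin n → ℕ) → 2 ∣ n → 2 ∣ suc m′ → suc m′ ≤ n → Scheme n m′ 2 layer
even-order-scheme layer (divides zero refl) _ ()
even-order-scheme {n} {m′} layer (divides (suc ν) n≡) (divides h m≡) m≤n =
  go layer (trans n≡ (trans (*-comm (suc ν) 2) (cong (suc ν +_) (+-identityʳ (suc ν)))))
  where
  h≤ν : h ≤ suc ν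
  h≤ν = *-cancelʳ-≤ h (suc ν) 2 (subst₂ _≤_ m≡ n≡ m≤n)
  go : ∀ {n} (layer : Fin n → ℕ) → n ≡ suc ν + suc ν → Scheme n m′ 2 layer
  go layer refl = evenScheme ν m′ h layer m≡ h≤ν

module Iterated {p r l} (G : Graph p) (regular : IsRegular G (2 * suc r)) (order : 2 * suc r + (3 + l) ≡ p + 2) where

  m = 3 + l

  m≤p : m ≤ p
  m≤p = +-cancelˡ-≤ 2 _ _ (begin
    2 + m            ≤⟨ +-monoˡ-≤ m (*-monoʳ-≤ 2 (s≤s z≤n)) ⟩
    2 * suc r + m    ≡⟨ order ⟩
    p + 2            ≡⟨ +-comm p 2 ⟩
    2 + p            ∎)
    where open ≤-Reasoning

  m-even⇔p-even : (2 ∣ m → 2 ∣ p) × (2 ∣ p → 2 ∣ m)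
  m-even⇔p-even =
    (λ 2∣m → ∣m+n∣m⇒∣n (subst (2 ∣_) (trans order (+-comm p 2)) (∣m∣n⇒∣m+n (m∣m*n (suc r)) 2∣m)) ∣-refl) ,
    (λ 2∣p → ∣m+n∣m⇒∣n (subst (2 ∣_) (sym order) (∣m∣n⇒∣m+n 2∣p ∣-refl)) (m∣m*n (suc r)))

  χla : ∀ {c t} → (∀ k → Scheme (iterOrder p m k) (2 + l) t (iterLayer p m k)) →
    (∀ M → ProperColouring (cycle m) M → t ≤ M) → (∀ M → ProperColouring G M → c ≤ M) →
    IsLocalAntimagicChromaticNumber G c → ∀ k → IsLocalAntimagicChromaticNumber (iterJoin G m k) (c + t * k)
  χla schemes cycle-bound G-bound la k = layered⇒χla
    (iterLabeling {G = G} regular order schemes (baseLabeling la) k)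
    (iterJoin-colours G m G-bound cycle-bound k)

  evenSchemes : 2 ∣ p → ∀ k → Scheme (iterOrder p m k) (2 + l) 2 (iterLayer p m k)
  evenSchemes 2∣p k = even-order-scheme (iterLayer p m k)
    (subst (2 ∣_) (sym (iterOrder≡ p m k)) (∣m∣n⇒∣m+n 2∣p (∣n⇒∣m*n k 2∣m))) 2∣m
    (≤-trans m≤p (subst (p ≤_) (sym (iterOrder≡ p m k)) (m≤m+n p (k * m))))
    where 2∣m = proj₂ m-even⇔p-even 2∣p

  double-even : ∀ s → 2 ∣ s + s
  double-even s = divides s (trans (cong (s +_) (sym (+-identityʳ s))) (*-comm 2 s))

  -- The recursion follows the layers: the base case joins the new cycle to `G`, of odd order, and
  -- each step adds the magic square joining it to one more of the earlier cycles.
  oddSchemes : ∀ κ μ → p ≡ suc (κ + κ) → 2 + l ≡ μ + μ → ∀ k → Scheme (iterOrder p m k) (2 + l) 3 (iterLayer p m k)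
  oddSchemes κ (suc μ₀) p≡ m′≡ zero = go (λ _ → 0) (trans p≡ (sym (+-suc κ κ)))
    where
    μ≤κ : suc μ₀ ≤ κ
    μ≤κ = ≮⇒≥ λ κ<μ → <⇒≱ (+-mono-< κ<μ κ<μ) (≤-pred (subst₂ _≤_ (cong suc m′≡) p≡ m≤p))
    go : ∀ {n} (layer : Fin n → ℕ) → n ≡ κ + suc κ → Scheme n (2 + l) 3 layer
    go layer refl = oddScheme κ μ₀ layer m′≡ μ≤κ
  oddSchemes κ μ p≡ m′≡ (suc k) = stackScheme μ m′≡ (oddSchemes κ μ p≡ m′≡ k) (iterLayer< p m k)

  χla-even : 2 ∣ p → ∀ {c} → (∀ M → ProperColouring G M → c ≤ M) → IsLocalAntimagicChromaticNumber G c →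
    ∀ k → IsLocalAntimagicChromaticNumber (iterJoin G m k) (c + 2 * k)
  χla-even 2∣p = χla (evenSchemes 2∣p) (λ _ → cycle-colours≥2)

  χla-odd : ¬ 2 ∣ p → ∀ {c} → (∀ M → ProperColouring G M → c ≤ M) → IsLocalAntimagicChromaticNumber G c →
    ∀ k → IsLocalAntimagicChromaticNumber (iterJoin G m k) (c + 3 * k)
  χla-odd 2∤p with halve p | halve (2 + l)
  ... | inj₁ (s , p≡) | _              = contradiction (subst (2 ∣_) (sym p≡) (double-even s)) 2∤p
  ... | inj₂ _        | inj₂ (s , m′≡) = contradiction (proj₁ m-even⇔p-even
    (subst (2 ∣_) (sym (cong suc m′≡)) (subst (2 ∣_) (cong suc (+-suc s s)) (double-even (suc s))))) 2∤p
  ... | inj₂ (κ , p≡) | inj₁ (μ , m′≡) = χla (oddSchemes κ μ p≡ m′≡)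
    (λ _ → odd-cycle-colours≥3 (subst (2 ∣_) (sym m′≡) (double-even μ)))

theorem3p7 : (r p : ℕ) (G : Graph p) →
    r ≥ 1 → p ≥ 3 → 2 * r ≤ p →
    IsRegular G (2 * r) →
    (Σ ℕ λ c → IsChromaticNumber G c × IsLocalAntimagicChromaticNumber G c) →
    (∀ k →
    iterOrder p (p ∸ 2 * r + 2) (suc k) ≡ p + suc k * (p ∸ 2 * r + 2) ×
    IsRegular (iterJoin G (p ∸ 2 * r + 2) (suc k)) (2 * r + suc k * (p ∸ 2 * r + 2)))
    ×
    (∀ c → IsLocalAntimagicChromaticNumber G c → ∀ k →
    (2 ∣ p → IsLocalAntimagicChromaticNumber (iterJoin G (p ∸ 2 * r + 2) k) (c + 2 * k)) ×
    (¬ 2 ∣ p → IsLocalAntimagicChromaticNumber (iterJoin G (p ∸ 2 * r + 2) k) (c + 3 * k)))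
theorem3p7 (suc r) p@(suc _) G r≥1 p≥3 2r≤p regular (c₀ , (_ , G-bound) , la₀) =
  main (p ∸ 2 * suc r + 2) (p ∸ 2 * suc r ∸ 1) m≡ order
  where
  2r<p : 2 * suc r < p
  2r<p = subst (_< p) (regular zero) (degree<order G zero)
  m≡ : p ∸ 2 * suc r + 2 ≡ 3 + (p ∸ 2 * suc r ∸ 1)
  m≡ = trans (+-comm (p ∸ 2 * suc r) 2) (cong (2 +_) (sym (m+[n∸m]≡n (m<n⇒0<n∸m 2r<p))))
  order : 2 * suc r + (p ∸ 2 * suc r + 2) ≡ p + 2
  order = trans (sym (+-assoc (2 * suc r) (p ∸ 2 * suc r) 2)) (cong (_+ 2) (m+[n∸m]≡n 2r≤p))
  -- Here `m` is a variable, so that matching its equation with 3 + l exposes the three vertices on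
  -- which the lemmas about cycles rely.
  main : ∀ m l → m ≡ 3 + l → 2 * suc r + m ≡ p + 2 →
    (∀ k → iterOrder p m (suc k) ≡ p + suc k * m × IsRegular (iterJoin G m (suc k)) (2 * suc r + suc k * m)) ×
    (∀ c → IsLocalAntimagicChromaticNumber G c → ∀ k →
      (2 ∣ p → IsLocalAntimagicChromaticNumber (iterJoin G m k) (c + 2 * k)) ×
      (¬ 2 ∣ p → IsLocalAntimagicChromaticNumber (iterJoin G m k) (c + 3 * k)))
  main _ l refl order =
    (λ k → iterOrder≡ p (3 + l) (suc k) , iterJoin-regular {G = G} regular order (suc k)) ,
    (λ c la k → let bound = λ M col → subst (_≤ M) (χla-unique la₀ la) (G-bound M col) in
      (λ even → χla-even even bound la k) , (λ odd → χla-odd odd bound la k))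
    where open Iterated {r = r} {l} G regular order
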